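{- Let $F$ be a graph such that $\mathrm{ex}(n,K_3,F)=o(n^2)$. Then $\mathrm{th}(F)\le (\chi(F)-1)(|V(F)|-1)+1$.
   Context: $\mathrm{ex}(n,H,F)$ (generalized Turán number) is the maximum number of copies of $H$ in an $F$-free $n$-vertex graph; asymptotics are as $n\to\infty$. A hypergraph $\mathcal{H}$ is a Berge copy of a graph $G$ if $V(G)\subseteq V(\mathcal{H})$ and there is a bijection $f:E(G)\to E(\mathcal{H})$ with $e\subseteq f(e)$ for all $e\in E(G)$. $\mathrm{ex}_r(n,\text{Berge- }F)$ is the maximum number of hyperedges in an $r$-uniform $n$-vertex hypergraph with no Berge copy of $F$. For every $F$ there is $r_0$ with $\mathrm{ex}_r(n,\text{Berge- }F)=o(n^2)$ for all $r\ge r_0$; the uniformity threshold $\mathrm{th}(F)$ is the smallest such $r_0$. $\chi(F)$ is the chromatic number of $F$. -}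

module Defs where

open import Data.Bool using (Bool; T; not)
open import Data.Fin using (Fin; _<_; _≟_)
open import Data.Fin.Subset using (Subset; _∈_; ∣_∣)
open import Data.Nat using (ℕ; _*_; _≤_; _≥_)
open import Data.Product using (∃; ∃-syntax; ∃₂; _×_; _,_; proj₁; proj₂)
open import Function using (Injective; _⇔_; _⤖_; Bijection; module Bijection)
import Function.Properties.Equivalence as ⇔
open import Level using (0ℓ)
open import Relation.Binary using (Setoid)
open import Relation.Binary.PropositionalEquality
  using (_≡_; _≢_; refl; sym; cong; setoid)
open import Relation.Nullary using (¬_; ⌊_⌋; yes; no)
open import Relation.Nullary.Negation using (contradiction)

IsLeast : (ℕ → Set) → ℕ → Set
IsLeast P n = P n × (∀ m → P m → n ≤ m)

IsGreatest : (ℕ → Set) → ℕ → Set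
IsGreatest P n = P n × (∀ m → P m → m ≤ n)

-- Extremal functions are given by their graphs: R n m reads "the value at n
-- is m".  The quantifier over ε > 0 is taken over ε = 1/k; for k = 0 the
-- inequality is trivial.  Points n where the function has no value (no
-- admissible object to maximise over) impose no condition.
IsLittleO-n² : (ℕ → ℕ → Set) → Set
IsLittleO-n² R =
  ∀ (k : ℕ) → ∃[ N ] (∀ n → n ≥ N → ∀ m → R n m → k * m ≤ n * n)

-- Finite simple graphs on the vertex set Fin n.
record Graph (n : ℕ) : Set where
  field
    adj    : Fin n → Fin n → Bool
    adjSym : ∀ u v → adj u v ≡ adj v u
    noLoop : ∀ u → ¬ T (adj u u)

  Adj : Fin n → Fin n → Set
  Adj u v = T (adj u v)

  -- Each unordered edge is represented once, by its increasing pair.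
  Edge : Set
  Edge = ∃₂ λ u v → u < v × Adj u v

open Graph public using (Adj; Edge)

complete : ∀ n → Graph n
complete n = record { adj = neq ; adjSym = neqSym ; noLoop = neqIrr }
  where
  neq : Fin n → Fin n → Bool
  neq u v = not ⌊ u ≟ v ⌋

  neqSym : ∀ u v → neq u v ≡ neq v u
  neqSym u v with u ≟ v | v ≟ u
  ... | yes _   | yes _   = refl
  ... | no _    | no _    = refl
  ... | yes u≡v | no v≢u  = contradiction (sym u≡v) v≢u
  ... | no u≢v  | yes v≡u = contradiction (sym v≡u) u≢v

  neqIrr : ∀ u → ¬ T (neq u u)
  neqIrr u p with u ≟ u
  ... | yes _  = p
  ... | no u≢u = u≢u refl

Colourable : ∀ {n} → Graph n → ℕ → Set
Colourable {n} G k =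
  ∃ λ (c : Fin n → Fin k) → ∀ u v → Adj G u v → c u ≢ c v

IsChromaticNumber : ∀ {n} → Graph n → ℕ → Set
IsChromaticNumber G = IsLeast (Colourable G)

-- Not necessarily induced.
record Embedding {h n} (H : Graph h) (G : Graph n) : Set where
  field
    map       : Fin h → Fin n
    injective : Injective _≡_ _≡_ map
    preserves : ∀ u v → Adj H u v → Adj G (map u) (map v)

  VertexOfImage : Fin n → Set
  VertexOfImage x = ∃[ u ] map u ≡ x

  EdgeOfImage : Fin n → Fin n → Set
  EdgeOfImage x y = ∃₂ λ u v → Adj H u v × map u ≡ x × map v ≡ y

open Embedding public using (VertexOfImage; EdgeOfImage)

-- A copy of H in G is a subgraph of G isomorphic to H, that is, an embedding
-- considered up to equality of its image.
Copies : ∀ {h n} → Graph h → Graph n → Setoid 0ℓ 0ℓ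
Copies H G = record
  { Carrier = Embedding H G
  ; _≈_     = λ φ ψ →
      (∀ x → VertexOfImage φ x ⇔ VertexOfImage ψ x) ×
      (∀ x y → EdgeOfImage φ x y ⇔ EdgeOfImage ψ x y)
  ; isEquivalence = record
      { refl  = (λ _ → ⇔.refl) , (λ _ _ → ⇔.refl)
      ; sym   = λ (p , q) → (λ x → ⇔.sym (p x)) , (λ x y → ⇔.sym (q x y))
      ; trans = λ (p , q) (p′ , q′) →
          (λ x → ⇔.trans (p x) (p′ x)) ,
          (λ x y → ⇔.trans (q x y) (q′ x y))
      }
  }

IsNumberOfCopies : ∀ {h n} → Graph h → Graph n → ℕ → Set
IsNumberOfCopies H G m = Bijection (setoid (Fin m)) (Copies H G)

Free : ∀ {f n} → Graph f → Graph n → Set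
Free F G = ¬ Embedding F G

-- IsEx H F n m : ex(n, H, F) = m.
IsEx : ∀ {h f} → Graph h → Graph f → ℕ → ℕ → Set
IsEx H F n = IsGreatest λ m →
  ∃ λ (G : Graph n) → Free F G × IsNumberOfCopies H G m

-- Hypergraphs on the vertex set Fin n, without repeated hyperedges.
record Hypergraph (n : ℕ) : Set where
  field
    size     : ℕ
    edge     : Fin size → Subset n
    distinct : Injective _≡_ _≡_ edge

open Hypergraph public using (size; edge)

Uniform : ∀ {n} → ℕ → Hypergraph n → Set
Uniform r 𝓗 = ∀ i → ∣ edge 𝓗 i ∣ ≡ r

-- Spanning subhypergraphs suffice for containment of Berge copies, since a
-- Berge copy may have vertices outside the underlying graph.
_⊑_ : ∀ {n} → Hypergraph n → Hypergraph n → Set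
𝓚 ⊑ 𝓗 = ∀ i → ∃[ j ] edge 𝓚 i ≡ edge 𝓗 j

-- The injection places the abstract graph F on vertices of 𝓗.
IsBergeCopy : ∀ {v n} → Graph v → Hypergraph n → Set
IsBergeCopy {v} {n} F 𝓗 =
  ∃ λ (φ : Fin v → Fin n) → Injective _≡_ _≡_ φ ×
  (∃ λ (f : Edge F ⤖ Fin (size 𝓗)) →
    ∀ (e : Edge F) → let (u , w , _) = e ; A = edge 𝓗 (Bijection.to f e) in
      φ u ∈ A × φ w ∈ A)

BergeFree : ∀ {v n} → Graph v → Hypergraph n → Set
BergeFree F 𝓗 = ¬ (∃ λ 𝓚 → 𝓚 ⊑ 𝓗 × IsBergeCopy F 𝓚)

-- IsExBerge r F n m : ex_r(n, Berge-F) = m.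
IsExBerge : ∀ {v} → ℕ → Graph v → ℕ → ℕ → Set
IsExBerge r F n = IsGreatest λ m →
  ∃ λ (𝓗 : Hypergraph n) → Uniform r 𝓗 × BergeFree F 𝓗 × size 𝓗 ≡ m

-- IsUniformityThreshold F t : th(F) = t.
IsUniformityThreshold : ∀ {v} → Graph v → ℕ → Set
IsUniformityThreshold F = IsLeast λ r₀ →
  ∀ r → r ≥ r₀ → IsLittleO-n² (IsExBerge r F)

{-# OPTIONS --safe #-}
module Submission where

open import Data.Bool using (true; false; T)
open import Data.Bool.Properties using (T?; T-irrelevant)
open import Data.Empty using (⊥; ⊥-elim)
open import Data.Fin as Fin using (Fin; zero; suc; _≟_; combine; remQuot; funToFin; finToFun; inject≤)
import Data.Fin.Properties as Fin
open import Data.Fin.Subset using (Subset; _∈_; ∣_∣)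
open import Data.Fin.Subset.Properties using (_∈?_)
open import Data.Nat hiding (_≟_)
open import Data.Nat.Properties hiding (_≟_)
open import Data.Nat.Solver using (module +-*-Solver)
open import Data.Product using (∃; ∃-syntax; ∃₂; _×_; _,_; proj₁; proj₂)
open import Data.Sum using (_⊎_; inj₁; inj₂; [_,_]′)
open import Data.Unit using (⊤; tt)
open import Data.Vec using ([]; _∷_)
open import Function using (_∘_; Injective; id; case_of_; mk⤖; mk⇔; module Equivalence; Bijection; module Bijection)
open import Level using (0ℓ)
open import Relation.Binary using (Setoid)
open import Relation.Binary.PropositionalEquality
open import Relation.Nullary using (¬_; Dec; yes; no; contradiction; _×-dec_; _⊎-dec_; ¬?; ⌊_⌋; ¬¬-excluded-middle; decidable-stable)
open import Relation.Nullary.Decidable using (toWitness; fromWitness)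
open import Relation.Unary using (Decidable)
import Algebra.Properties.Semiring.Sum +-*-semiring as Sum
open +-*-Solver using (solve; _:+_; _:*_; _:=_; con)
open import Defs

-- Call a pair of vertices heavy if it lies in at least twice as many hyperedges
-- as F has edges.  Greedily, a Berge-F-free hypergraph has no hyperedge with v
-- pairwise heavy vertices, so every hyperedge with more than (χ − 1)(v − 1)
-- vertices contains a light pair with a common heavy neighbour, or χ pairwise
-- light vertices.  In the first case the heavy pairs and these light pairs form
-- an F-free graph, and each such hyperedge gives a triangle, up to bounded
-- multiplicity; there are o(n²) of them by hypothesis.  In the second case,
-- bounded thinning makes the light χ-sets share no pair.  If there are Ω(n²) of
-- them, their pairs contain a blow-up of K_χ with parts of size v and without
-- two edges from the same χ-set, hence a Berge copy of F.
--
-- For χ = 2 this is the Kővári–Sós–Turán theorem.  For χ = 3 it is a form of the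
-- (6,3)-theorem, for which the regularity lemma is not needed: if almost all
-- vertices c have few edges between their two neighbourhoods, then each round
-- of refining a partition uncovers a positive proportion of n² pairs, in products
-- of traces of such neighbourhoods, that span few edges; so there are boundedly
-- many rounds.  For χ ≥ 4 the complete tripartite graph violates the hypothesis.

-- For χ = 3 the obstacle is that distinct edges of F must get distinct hyperedges, so no triangle
-- of the blow-up may be one of the given triples. This is built into the notion of a link: if the
-- pair of a triple is linked to c, the three sides of the resulting triangle come from three
-- different triples. A bounded number of vertices with n²/K links each is then enough: some s of
-- them are linked to a common positive proportion of the pairs, and a complete bipartite graph
-- among those pairs completes the blow-up. To find such vertices, both sides are partitioned and
-- products of sets are marked. A typical triple with an unmarked pair has a third vertex c whose
-- two neighbourhoods fill a fixed proportion of the atoms containing the pair. The edges of triples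
-- inside the product of these neighbourhoods are links of c, up to at most n of them, so they are
-- few if c has few links. The potential that ends the process is the marked area itself, which
-- never exceeds n².

private variable
  k m n : ℕ
  A B : Set

-- Counting with sums of indicators

opaque
  𝟙 : Dec A → ℕ
  𝟙 (yes _) = 1
  𝟙 (no  _) = 0

  𝟙-yes : (A? : Dec A) → A → 𝟙 A? ≡ 1
  𝟙-yes (yes _) _ = refl
  𝟙-yes (no ¬a) a = contradiction a ¬a

  𝟙-no : (A? : Dec A) → ¬ A → 𝟙 A? ≡ 0
  𝟙-no (yes a) ¬a = contradiction a ¬a
  𝟙-no (no _)  _  = refl

  𝟙≤1 : (A? : Dec A) → 𝟙 A? ≤ 1
  𝟙≤1 (yes _) = ≤-refl
  𝟙≤1 (no _)  = z≤n

  𝟙-mono : (A? : Dec A) (B? : Dec B) → (A → B) → 𝟙 A? ≤ 𝟙 B?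
  𝟙-mono (yes a) B? f = ≤-reflexive (sym (𝟙-yes B? (f a)))
  𝟙-mono (no _)  B? f = z≤n

  𝟙-× : (A? : Dec A) (B? : Dec B) → 𝟙 (A? ×-dec B?) ≡ 𝟙 A? * 𝟙 B?
  𝟙-× (yes _) (yes _) = refl
  𝟙-× (yes _) (no _)  = refl
  𝟙-× (no _)  _       = refl

opaque
  unfolding 𝟙

  sum : (Fin n → ℕ) → ℕ
  sum = Sum.sum

  sum-cong : {f g : Fin n → ℕ} → (∀ i → f i ≡ g i) → sum f ≡ sum g
  sum-cong = Sum.sum-cong-≗

  sum-+ : (f g : Fin n → ℕ) → sum (λ i → f i + g i) ≡ sum f + sum g
  sum-+ = Sum.∑-distrib-+

  sum-comm : (f : Fin m → Fin n → ℕ) →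
    sum (λ i → sum (f i)) ≡ sum (λ j → sum (λ i → f i j))
  sum-comm = Sum.∑-comm

  sum-* : (c : ℕ) (f : Fin n → ℕ) → c * sum f ≡ sum (λ i → c * f i)
  sum-* = Sum.*-distribˡ-sum

  sum-mono : {f g : Fin n → ℕ} → (∀ i → f i ≤ g i) → sum f ≤ sum g
  sum-mono {zero}  _   = z≤n
  sum-mono {suc n} f≤g = +-mono-≤ (f≤g zero) (sum-mono (f≤g ∘ suc))

  sum-≤-const : (c : ℕ) {f : Fin n → ℕ} → (∀ i → f i ≤ c) → sum f ≤ n * c
  sum-≤-const {zero}  c _   = z≤n
  sum-≤-const {suc n} c f≤c = +-mono-≤ (f≤c zero) (sum-≤-const c (f≤c ∘ suc))

  sum-const : (n c : ℕ) → sum {n} (λ _ → c) ≡ n * c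
  sum-const zero    c = refl
  sum-const (suc n) c = cong (c +_) (sum-const n c)

  const-≤-sum : (c : ℕ) {f : Fin n → ℕ} → (∀ i → c ≤ f i) → n * c ≤ sum f
  const-≤-sum {n} c c≤f = subst (_≤ _) (sum-const n c) (sum-mono c≤f)

  sum-zero : {f : Fin n → ℕ} → (∀ i → f i ≡ 0) → sum f ≡ 0
  sum-zero {n} f≡0 = trans (sum-cong f≡0) (Sum.sum-replicate-zero n)

  sum-δ : (i : Fin n) (f : Fin n → ℕ) → sum (λ j → 𝟙 (i ≟ j) * f j) ≡ f i
  sum-δ {suc n} zero f = begin
    f zero + 0 + sum (λ j → 𝟙 (zero ≟ suc j) * f (suc j))
      ≡⟨ cong₂ _+_ (+-identityʳ _) (sum-zero {n} λ _ → refl) ⟩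
    f zero + 0 ≡⟨ +-identityʳ _ ⟩
    f zero ∎
    where open ≡-Reasoning
  sum-δ {suc n} (suc i) f = trans
    (sum-cong λ j → cong (_* f (suc j)) (𝟙-suc j))
    (sum-δ i (f ∘ suc))
    where
    𝟙-suc : ∀ j → 𝟙 (suc i ≟ suc j) ≡ 𝟙 (i ≟ j)
    𝟙-suc j with i ≟ j
    ... | yes _ = refl
    ... | no  _ = refl

opaque
  unfolding sum

  term-≤-sum : (f : Fin n → ℕ) (i : Fin n) → f i ≤ sum f
  term-≤-sum f zero    = m≤m+n _ _
  term-≤-sum f (suc i) = ≤-trans (term-≤-sum (f ∘ suc) i) (m≤n+m _ _)

module _ {P : Fin n → Set} where

  # : Decidable P → ℕ
  # P? = sum (λ i → 𝟙 (P? i))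

  #-≤ : (P? : Decidable P) → # P? ≤ n
  #-≤ P? = ≤-trans (sum-≤-const 1 (𝟙≤1 ∘ P?)) (≤-reflexive (*-identityʳ n))

  #-⊆ : {Q : Fin n → Set} (P? : Decidable P) (Q? : Decidable Q) →
    (∀ i → P i → Q i) → # P? ≤ sum (λ i → 𝟙 (Q? i))
  #-⊆ P? Q? P⊆Q = sum-mono λ i → 𝟙-mono (P? i) (Q? i) (P⊆Q i)

  #-∃ : (P? : Decidable P) → 0 < # P? → ∃ P
  #-∃ P? 0<# with Fin.any? P?
  ... | yes p = p
  ... | no ¬p = contradiction (sum-zero (λ i → 𝟙-no (P? i) λ p → ¬p (i , p))) (>⇒≢ 0<#)

opaque
  unfolding 𝟙

  #-⊆-∪ : {P Q R : Fin n → Set} (P? : Decidable P) (Q? : Decidable Q) (R? : Decidable R) →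
    (∀ i → P i → Q i ⊎ R i) → # P? ≤ # Q? + # R?
  #-⊆-∪ P? Q? R? f = ≤-trans (sum-mono pointwise) (≤-reflexive (sum-+ (λ i → 𝟙 (Q? i)) _))
    where
    pointwise : ∀ i → 𝟙 (P? i) ≤ 𝟙 (Q? i) + 𝟙 (R? i)
    pointwise i with P? i
    ... | no _ = z≤n
    ... | yes p with f i p
    ...   | inj₁ q = ≤-trans (≤-reflexive (sym (𝟙-yes (Q? i) q))) (m≤m+n _ _)
    ...   | inj₂ r = ≤-trans (≤-reflexive (sym (𝟙-yes (R? i) r))) (m≤n+m _ _)

opaque
  unfolding sum 𝟙

  #-unique : {P : Fin n → Set} (P? : Decidable P) →
    (∀ i j → P i → P j → i ≡ j) → # P? ≤ 1
  #-unique {zero}  P? _ = z≤n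
  #-unique {suc n} P? u with P? zero
  ... | yes p = s≤s (≤-reflexive (sum-zero λ i → 𝟙-no (P? (suc i)) λ q → contradiction (u zero (suc i) p q) λ ()))
  ... | no _  = #-unique (P? ∘ suc) λ i j p q → Fin.suc-injective (u (suc i) (suc j) p q)

#-single : (i : Fin n) → # (i ≟_) ≡ 1
#-single {n} i = trans (sum-cong λ j → sym (*-identityʳ (𝟙 (i ≟ j)))) (sum-δ i (λ _ → 1))

module _ (α : Fin n → Fin k) where

  sum-fibres : (f : Fin n → ℕ) → sum f ≡ sum (λ I → sum (λ x → 𝟙 (α x ≟ I) * f x))
  sum-fibres f = trans
    (sum-cong λ x → sym (sum-δ (α x) (λ _ → f x)))
    (sum-comm λ x I → 𝟙 (α x ≟ I) * f x)

  ∃-large-fibre : {P : Fin n → Set} (P? : Decidable P) → 0 < # P? →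
    ∃[ I ] # P? ≤ k * # (λ x → α x ≟ I ×-dec P? x)
  ∃-large-fibre P? 0<# with
    Fin.any? (λ I → # P? ≤? k * # (λ x → α x ≟ I ×-dec P? x))
  ... | yes p = p
  ... | no ¬p = contradiction total (<⇒≱ (strict 0<#))
    where
    c : Fin k → ℕ
    c I = # (λ x → α x ≟ I ×-dec P? x)
    #≡ : # P? ≡ sum c
    #≡ = trans (sum-fibres (λ x → 𝟙 (P? x)))
      (sum-cong λ I → sum-cong λ x → sym (𝟙-× (α x ≟ I) (P? x)))
    small : ∀ I → suc (k * c I) ≤ # P?
    small I = ≰⇒> λ le → ¬p (I , le)
    total : # P? * k ≤ k * sum c
    total = ≤-reflexive (trans (*-comm (# P?) k) (cong (k *_) #≡))
    bound : k * 1 + k * sum c ≤ k * # P?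
    bound = begin
      k * 1 + k * sum c                      ≡⟨ cong₂ _+_ (sym (sum-const k 1)) (sum-* k c) ⟩
      sum {k} (λ _ → 1) + sum (λ I → k * c I) ≡⟨ sym (sum-+ (λ _ → 1) _) ⟩
      sum (λ I → 1 + k * c I)                ≤⟨ sum-≤-const (# P?) small ⟩
      k * # P?                               ∎
      where open ≤-Reasoning
    strict : 0 < # P? → k * sum c < # P? * k
    strict 0<# = begin-strict
      k * sum c          <⟨ m<n+m (k * sum c) {k * 1} (subst (0 <_) (sym (*-identityʳ k)) 0<k) ⟩
      k * 1 + k * sum c  ≤⟨ bound ⟩
      k * # P?           ≡⟨ *-comm k _ ⟩
      # P? * k           ∎
      where
      open ≤-Reasoning
      0<k : 0 < k
      0<k = ≤-<-trans z≤n (Fin.toℕ<n (α (proj₁ (#-∃ P? 0<#))))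

record Enumeration (P : Fin n → Set) (q : ℕ) : Set where
  field
    at       : Fin q → Fin n
    at-inj   : Injective _≡_ _≡_ at
    at-∈     : ∀ i → P (at i)
    index    : ∀ x → P x → ∃[ i ] at i ≡ x

open Enumeration

opaque
  unfolding sum 𝟙

  enumerate : {P : Fin n → Set} (P? : Decidable P) → Enumeration P (# P?)
  enumerate {zero}  P? = record { at = λ () ; at-inj = λ {} ; at-∈ = λ () ; index = λ () }
  enumerate {suc n} {P} P? = go (P? zero)
    where
    E : Enumeration (P ∘ suc) (# (P? ∘ suc))
    E = enumerate (P? ∘ suc)
    go : (P₀? : Dec (P zero)) → Enumeration P (𝟙 P₀? + # (P? ∘ suc))
    go (no ¬p) = record
      { at     = suc ∘ at E
      ; at-inj = at-inj E ∘ Fin.suc-injective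
      ; at-∈   = at-∈ E
      ; index  = λ { zero p → contradiction p ¬p
                   ; (suc x) p → let i , eq = index E x p in i , cong suc eq }
      }
    go (yes p) = record
      { at     = f
      ; at-inj = λ {i} {j} → f-inj i j
      ; at-∈   = λ { zero → p ; (suc i) → at-∈ E i }
      ; index  = λ { zero _ → zero , refl
                   ; (suc x) p → let i , eq = index E x p in suc i , cong suc eq }
      }
      where
      f : Fin (suc (# (P? ∘ suc))) → Fin (suc n)
      f zero    = zero
      f (suc i) = suc (at E i)
      f-inj : ∀ i j → f i ≡ f j → i ≡ j
      f-inj zero    zero    _  = refl
      f-inj (suc i) (suc j) eq = cong suc (at-inj E (Fin.suc-injective eq))

choose : {P : Fin n → Set} (P? : Decidable P) → m ≤ # P? →
  ∃ λ (f : Fin m → Fin n) → Injective _≡_ _≡_ f × ∀ i → P (f i)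
choose P? m≤# =
  (λ i → at E (inject≤ i m≤#)) ,
  (λ {i} {j} eq → Fin.inject≤-injective m≤# m≤# i j (at-inj E eq)) ,
  (λ i → at-∈ E _)
  where E = enumerate P?

PairInjective : (Fin m → Fin n) → (Fin m → Fin k) → Set
PairInjective x y = ∀ i j → x i ≡ x j → y i ≡ y j → i ≡ j

-- Each term is expanded over all `(a , b)` by two Kronecker deltas; after exchanging the sums,
-- `PairInjective` leaves at most one index `i` for each `(a , b)`.
sum-pairs : (x : Fin m → Fin n) (y : Fin m → Fin k) → PairInjective x y →
  (g : Fin n → Fin k → ℕ) → sum (λ i → g (x i) (y i)) ≤ sum (λ a → sum (λ b → g a b))
sum-pairs x y inj g = begin
  sum (λ i → g (x i) (y i))
    ≡⟨ sum-cong (λ i → sym (trans (sum-δ (x i) _) (sum-δ (y i) (g (x i))))) ⟩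
  sum (λ i → sum (λ a → 𝟙 (x i ≟ a) * sum (λ b → 𝟙 (y i ≟ b) * g a b)))
    ≡⟨ sum-comm (λ i a → 𝟙 (x i ≟ a) * sum (λ b → 𝟙 (y i ≟ b) * g a b)) ⟩
  sum (λ a → sum (λ i → 𝟙 (x i ≟ a) * sum (λ b → 𝟙 (y i ≟ b) * g a b)))
    ≡⟨ sum-cong (λ a → trans (sum-cong λ i → sum-* (𝟙 (x i ≟ a)) (λ b → 𝟙 (y i ≟ b) * g a b))
         (sum-comm (λ i b → 𝟙 (x i ≟ a) * (𝟙 (y i ≟ b) * g a b)))) ⟩
  sum (λ a → sum (λ b → sum (λ i → 𝟙 (x i ≟ a) * (𝟙 (y i ≟ b) * g a b))))
    ≤⟨ sum-mono (λ a → sum-mono (λ b → bound a b)) ⟩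
  sum (λ a → sum (λ b → g a b)) ∎
  where
  open ≤-Reasoning
  bound : ∀ a b → sum (λ i → 𝟙 (x i ≟ a) * (𝟙 (y i ≟ b) * g a b)) ≤ g a b
  bound a b = begin
    sum (λ i → 𝟙 (x i ≟ a) * (𝟙 (y i ≟ b) * g a b))
      ≡⟨ sum-cong (λ i → trans (sym (*-assoc (𝟙 (x i ≟ a)) _ _))
           (trans (*-comm _ (g a b)) (cong (g a b *_) (sym (𝟙-× (x i ≟ a) (y i ≟ b)))))) ⟩
    sum (λ i → g a b * 𝟙 (x i ≟ a ×-dec y i ≟ b))
      ≡⟨ sym (sum-* (g a b) _) ⟩
    g a b * # (λ i → x i ≟ a ×-dec y i ≟ b)
      ≤⟨ *-monoʳ-≤ (g a b) (#-unique _ λ i j (p , q) (p′ , q′) →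
           inj i j (trans p (sym p′)) (trans q (sym q′))) ⟩
    g a b * 1 ≡⟨ *-identityʳ _ ⟩
    g a b ∎

pairs-≤ : (x : Fin m → Fin n) (y : Fin m → Fin k) → PairInjective x y → m ≤ n * k
pairs-≤ {m} {n} {k} x y inj = begin
  m                       ≡⟨ *-identityʳ m ⟨
  m * 1                   ≡⟨ sum-const m 1 ⟨
  sum {m} (λ _ → 1)       ≤⟨ sum-pairs x y inj (λ _ _ → 1) ⟩
  sum {n} (λ _ → sum {k} (λ _ → 1))  ≡⟨ trans (sum-const n _) (cong (n *_) (trans (sum-const k 1) (*-identityʳ k))) ⟩
  n * k                   ∎
  where open ≤-Reasoning

0<*⇒0<ʳ : ∀ a {b} → 0 < a * b → 0 < b
0<*⇒0<ʳ a {zero}  p = contradiction p (<-irrefl (sym (*-zeroʳ a)))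
0<*⇒0<ʳ a {suc b} p = z<s

-- Common intersections and complete bipartite subgraphs

bit : Dec A → Fin 2
bit (yes _) = suc zero
bit (no  _) = zero

bit-transfer : (A? : Dec A) (B? : Dec B) → bit A? ≡ bit B? → A → B
bit-transfer (yes _) (yes b) _ _ = b
bit-transfer (no ¬a) _       _ a = contradiction a ¬a

bits : {P : Fin n → Set} → Decidable P → Fin (2 ^ n)
bits P? = funToFin (λ j → bit (P? j))

bits-transfer : {P Q : Fin n → Set} (P? : Decidable P) (Q? : Decidable Q) →
  bits P? ≡ bits Q? → ∀ j → P j → Q j
bits-transfer P? Q? eq j = bit-transfer (P? j) (Q? j)
  (trans (sym (Fin.finToFun-funToFin _ j))
    (trans (cong (λ c → finToFun c j) eq) (Fin.finToFun-funToFin _ j)))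

-- A point lying in at least s of the sets is labelled by the collection of
-- sets containing it; a popular label provides the s sets.
dense-intersection : (s K : ℕ) .{{_ : NonZero K}} {u w : ℕ} → 0 < w → u ≤ w →
  let M = suc s * K in
  {S : Fin M → Fin u → Set} (S? : ∀ j → Decidable (S j)) →
  (∀ j → w ≤ K * # (S? j)) →
  ∃ λ (c : Fin s → Fin M) → Injective _≡_ _≡_ c ×
  ∃₂ λ q (e : Fin q → Fin u) → Injective _≡_ _≡_ e ×
  w ≤ M * 2 ^ M * q × (∀ i k → S (c k) (e i))
dense-intersection s K {u} {w} 0<w u≤w {S} S? large =
  c , c-inj , q , at E , at-inj E , w≤q , common
  where
  open ≤-Reasoning
  M = suc s * K
  deg : Fin u → ℕ
  deg i = # (λ j → S? j i)
  rich? : Decidable (λ i → s ≤ deg i)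
  rich? i = s ≤? deg i

  deg-≤ : ∀ i → deg i ≤ s + M * 𝟙 (rich? i)
  deg-≤ i = by-cases (rich? i)
    where
    by-cases : (d : Dec (s ≤ deg i)) → deg i ≤ s + M * 𝟙 d
    by-cases d@(yes p) = ≤-trans (#-≤ _) (≤-trans
      (≤-reflexive (sym (trans (cong (M *_) (𝟙-yes d p)) (*-identityʳ M)))) (m≤n+m _ s))
    by-cases (no ¬p) = ≤-trans (<⇒≤ (≰⇒> ¬p)) (m≤m+n s _)

  -- The M sets have total size at least `M * w / K`, which is `suc s * w`. The points in fewer than
  -- s sets account for at most `s * w` of it, so the rich points, of degree at most M, account for
  -- at least `w`.
  double : suc s * w ≤ s * w + M * # rich?
  double = *-cancelˡ-≤ K (begin
    K * (suc s * w)          ≡⟨ trans (sym (*-assoc K (suc s) w)) (cong (_* w) (*-comm K (suc s))) ⟩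
    M * w                    ≤⟨ const-≤-sum w large ⟩
    sum (λ j → K * # (S? j)) ≡⟨ sum-* K (λ j → # (S? j)) ⟨
    K * sum (λ j → # (S? j)) ≡⟨ cong (K *_) (sum-comm (λ j i → 𝟙 (S? j i))) ⟩
    K * sum deg              ≤⟨ *-monoʳ-≤ K deg-sum ⟩
    K * (s * w + M * # rich?) ∎)
    where
    deg-sum : sum deg ≤ s * w + M * # rich?
    deg-sum = begin
      sum deg                              ≤⟨ sum-mono deg-≤ ⟩
      sum (λ i → s + M * 𝟙 (rich? i))      ≡⟨ sum-+ (λ _ → s) _ ⟩
      sum {u} (λ _ → s) + sum (λ i → M * 𝟙 (rich? i))
        ≡⟨ cong₂ _+_ (trans (sum-const u s) (*-comm u s)) (sym (sum-* M _)) ⟩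
      s * u + M * # rich?                  ≤⟨ +-monoˡ-≤ _ (*-monoʳ-≤ s u≤w) ⟩
      s * w + M * # rich?                  ∎

  w≤rich : w ≤ M * # rich?
  w≤rich = +-cancelˡ-≤ (s * w) _ _ (≤-trans (≤-reflexive (+-comm (s * w) w)) double)

  0<rich : 0 < # rich?
  0<rich = 0<*⇒0<ʳ M (<-≤-trans 0<w w≤rich)

  label : Fin u → Fin (2 ^ M)
  label i = bits (λ j → S? j i)

  popular = ∃-large-fibre label rich? 0<rich
  I = proj₁ popular
  class? = λ i → label i ≟ I ×-dec rich? i
  q = # class?
  E = enumerate class?

  0<q : 0 < q
  0<q = 0<*⇒0<ʳ (2 ^ M) (<-≤-trans 0<rich (proj₂ popular))

  w≤q : w ≤ M * 2 ^ M * q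
  w≤q = begin
    w                   ≤⟨ w≤rich ⟩
    M * # rich?         ≤⟨ *-monoʳ-≤ M (proj₂ popular) ⟩
    M * (2 ^ M * q)     ≡⟨ sym (*-assoc M (2 ^ M) q) ⟩
    M * 2 ^ M * q       ∎

  i₀ = #-∃ class? 0<q
  chosen = choose (λ j → S? j (proj₁ i₀)) (proj₂ (proj₂ i₀))
  c = proj₁ chosen
  c-inj = proj₁ (proj₂ chosen)
  common : ∀ i k → S (c k) (at E i)
  common i k = bits-transfer (λ j → S? j (proj₁ i₀)) (λ j → S? j (at E i))
    (trans (proj₁ (proj₂ i₀)) (sym (proj₁ (at-∈ E i)))) (c k) (proj₂ (proj₂ chosen) k)

-- The first summand provides M vertices of large degree, the second makes their common
-- neighbourhood reach size s, and the successor makes n positive.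
kst-bound : ℕ → ℕ → ℕ
kst-bound s K = let M = suc s * (2 * K) in suc (2 * K * M + M * 2 ^ M * s)

-- The vertices of degree below n/(2K) carry at most half of the n²/K edges, so at least n/(2K)
-- vertices have larger degree. The neighbourhoods of M of these are the sets to which
-- `dense-intersection` applies. The two sides are separate copies of the vertex set.
kővári–sós–turán : (s K : ℕ) .{{_ : NonZero K}} {n q : ℕ} → kst-bound s K ≤ n →
  (x y : Fin q → Fin n) → PairInjective x y → n * n ≤ K * q →
  ∃₂ λ (a b : Fin s → Fin n) → Injective _≡_ _≡_ a × Injective _≡_ _≡_ b ×
  (∀ i j → ∃[ e ] x e ≡ a i × y e ≡ b j)
kővári–sós–turán s K {n} {q} N≤n x y inj dense =
  a , b , (λ eq → c-inj (g-inj eq)) ,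
  (λ {i} {j} eq → Fin.inject≤-injective s≤q s≤q i j (e-inj eq)) ,
  λ i j → common (inject≤ j s≤q) i
  where
  open ≤-Reasoning
  instance
    2K≢0 : NonZero (2 * K)
    2K≢0 = m*n≢0 2 K
    M≢0 : NonZero (suc s * (2 * K))
    M≢0 = m*n≢0 (suc s) (2 * K)
    R≢0 : NonZero (suc s * (2 * K) * 2 ^ (suc s * (2 * K)))
    R≢0 = m*n≢0 _ _ {{M≢0}} {{m^n≢0 2 (suc s * (2 * K))}}
    n≢0 : NonZero n
    n≢0 = >-nonZero (≤-trans z<s N≤n)
  M = suc s * (2 * K)
  N? : ∀ x′ → Decidable (λ y′ → ∃[ e ] x e ≡ x′ × y e ≡ y′)
  N? x′ y′ = Fin.any? λ e → x e ≟ x′ ×-dec y e ≟ y′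
  rich? : Decidable (λ x′ → n ≤ 2 * K * # (N? x′))
  rich? x′ = n ≤? 2 * K * # (N? x′)

  q≤deg : q ≤ sum (λ x′ → # (N? x′))
  q≤deg = begin
    q                                     ≡⟨ trans (sum-const q 1) (*-identityʳ q) ⟨
    sum {q} (λ _ → 1)                     ≡⟨ sum-cong (λ e → sym (𝟙-yes (N? (x e) (y e)) (e , refl , refl))) ⟩
    sum (λ e → 𝟙 (N? (x e) (y e)))        ≤⟨ sum-pairs x y inj (λ a b → 𝟙 (N? a b)) ⟩
    sum (λ x′ → # (N? x′))                ∎

  deg-≤ : ∀ x′ → 2 * K * # (N? x′) ≤ n + 2 * K * n * 𝟙 (rich? x′)
  deg-≤ x′ = by-cases (rich? x′)
    where
    by-cases : (d : Dec (n ≤ 2 * K * # (N? x′))) → 2 * K * # (N? x′) ≤ n + 2 * K * n * 𝟙 d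
    by-cases d@(yes p) = ≤-trans (*-monoʳ-≤ (2 * K) (#-≤ (N? x′))) (≤-trans
      (≤-reflexive (sym (trans (cong (2 * K * n *_) (𝟙-yes d p)) (*-identityʳ _)))) (m≤n+m _ n))
    by-cases (no ¬p) = ≤-trans (<⇒≤ (≰⇒> ¬p)) (m≤m+n n _)

  n≤rich : n ≤ 2 * K * # rich?
  n≤rich = *-cancelˡ-≤ n (+-cancelˡ-≤ (n * n) _ _ (begin
    n * n + n * n                         ≡⟨ cong (n * n +_) (sym (+-identityʳ _)) ⟩
    2 * (n * n)                           ≤⟨ *-monoʳ-≤ 2 dense ⟩
    2 * (K * q)                           ≡⟨ *-assoc 2 K q ⟨
    2 * K * q                             ≤⟨ *-monoʳ-≤ (2 * K) q≤deg ⟩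
    2 * K * sum (λ x′ → # (N? x′))        ≡⟨ sum-* (2 * K) (λ x′ → # (N? x′)) ⟩
    sum (λ x′ → 2 * K * # (N? x′))        ≤⟨ sum-mono deg-≤ ⟩
    sum (λ x′ → n + 2 * K * n * 𝟙 (rich? x′)) ≡⟨ sum-+ (λ _ → n) _ ⟩
    sum {n} (λ _ → n) + sum (λ x′ → 2 * K * n * 𝟙 (rich? x′))
      ≡⟨ cong₂ _+_ (sum-const n n) (sym (sum-* (2 * K * n) _)) ⟩
    n * n + 2 * K * n * # rich?
      ≡⟨ cong (n * n +_) (solve 3 (λ a b c → a :* b :* c := b :* (a :* c)) refl (2 * K) n (# rich?)) ⟩
    n * n + n * (2 * K * # rich?)         ∎))

  M≤rich : M ≤ # rich?
  M≤rich = *-cancelˡ-≤ (2 * K) (≤-trans (≤-trans (m≤n⇒m≤1+n (m≤m+n _ _)) N≤n) n≤rich)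

  vertices = choose rich? M≤rich
  g = proj₁ vertices
  g-inj = proj₁ (proj₂ vertices)
  tuple = dense-intersection s (2 * K) (>-nonZero⁻¹ n) ≤-refl (λ j → N? (g j)) (proj₂ (proj₂ vertices))
  c = proj₁ tuple
  c-inj = proj₁ (proj₂ tuple)
  q′ = proj₁ (proj₂ (proj₂ tuple))
  e = proj₁ (proj₂ (proj₂ (proj₂ tuple)))
  e-inj = proj₁ (proj₂ (proj₂ (proj₂ (proj₂ tuple))))
  n≤q′ = proj₁ (proj₂ (proj₂ (proj₂ (proj₂ (proj₂ tuple)))))
  common = proj₂ (proj₂ (proj₂ (proj₂ (proj₂ (proj₂ tuple)))))

  s≤q : s ≤ q′
  s≤q = *-cancelˡ-≤ (M * 2 ^ M) (≤-trans (≤-trans (m≤n⇒m≤1+n (m≤n+m _ (2 * K * M))) N≤n) n≤q′)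

  a b : Fin s → Fin n
  a i = g (c i)
  b j = e (inject≤ j s≤q)

-- Products of atoms and traces of neighbourhoods

𝟙-≡-subst : {i j : Fin n} (i≟j : Dec (i ≡ j)) (f : Fin n → ℕ) → 𝟙 i≟j * f i ≡ 𝟙 i≟j * f j
𝟙-≡-subst (yes refl) f = refl
𝟙-≡-subst (no i≢j)   f = trans (cong (_* _) (𝟙-no (no i≢j) i≢j)) (sym (cong (_* _) (𝟙-no (no i≢j) i≢j)))

𝟙-+-≤ : {C : Set} (A? : Dec A) (B? : Dec B) (C? : Dec C) →
  (A → C) → (B → C) → (A → ¬ B) → 𝟙 A? + 𝟙 B? ≤ 𝟙 C?
𝟙-+-≤ A?@(yes a) B? C? f g disj = ≤-reflexive
  (trans (cong₂ _+_ (𝟙-yes A? a) (𝟙-no B? (disj a))) (sym (𝟙-yes C? (f a))))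
𝟙-+-≤ A?@(no ¬a) B? C? f g disj = subst (λ t → t + 𝟙 B? ≤ 𝟙 C?) (sym (𝟙-no A? ¬a)) (𝟙-mono B? C? g)

-- The weights may depend on the cell `(I , J)`; thus both the area of a set of cells and the area
-- of a product chosen separately inside each cell are covered.
product-fibres : {p q : ℕ} (α : Fin m → Fin p) (β : Fin n → Fin q)
  (f : Fin p → Fin q → Fin m → ℕ) (g : Fin p → Fin q → Fin n → ℕ) →
  sum (λ a → sum (λ b → f (α a) (β b) a * g (α a) (β b) b)) ≡
  sum (λ I → sum (λ J → sum (λ a → 𝟙 (α a ≟ I) * f I J a) * sum (λ b → 𝟙 (β b ≟ J) * g I J b)))
product-fibres α β f g = begin
  sum (λ a → sum (λ b → f (α a) (β b) a * g (α a) (β b) b))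
    ≡⟨ sum-fibres α _ ⟩
  sum (λ I → sum (λ a → 𝟙 (α a ≟ I) * sum (λ b → f (α a) (β b) a * g (α a) (β b) b)))
    ≡⟨ sum-cong (λ I → sum-cong λ a → 𝟙-≡-subst (α a ≟ I) (λ I → sum (λ b → f I (β b) a * g I (β b) b))) ⟩
  sum (λ I → sum (λ a → 𝟙 (α a ≟ I) * sum (λ b → f I (β b) a * g I (β b) b)))
    ≡⟨ sum-cong (λ I → sum-cong λ a → cong (𝟙 (α a ≟ I) *_) (inner I a)) ⟩
  sum (λ I → sum (λ a → 𝟙 (α a ≟ I) * sum (λ J → f I J a * G I J)))
    ≡⟨ sum-cong (λ I → trans
         (sum-cong λ a → trans (sum-* (𝟙 (α a ≟ I)) (λ J → f I J a * G I J))
           (sum-cong λ J → sym (*-assoc (𝟙 (α a ≟ I)) (f I J a) (G I J))))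
         (sum-comm (λ a J → 𝟙 (α a ≟ I) * f I J a * G I J))) ⟩
  sum (λ I → sum (λ J → sum (λ a → 𝟙 (α a ≟ I) * f I J a * G I J)))
    ≡⟨ sum-cong (λ I → sum-cong λ J → sum-*ʳ (G I J) (λ a → 𝟙 (α a ≟ I) * f I J a)) ⟩
  sum (λ I → sum (λ J → sum (λ a → 𝟙 (α a ≟ I) * f I J a) * G I J)) ∎
  where
  open ≡-Reasoning
  G : _ → _ → ℕ
  G I J = sum (λ b → 𝟙 (β b ≟ J) * g I J b)
  sum-*ʳ : {l : ℕ} (c : ℕ) (h : Fin l → ℕ) → sum (λ a → h a * c) ≡ sum h * c
  sum-*ʳ c h = trans (sum-cong λ a → *-comm (h a) c) (trans (sym (sum-* c h)) (*-comm c (sum h)))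
  inner : ∀ I a → sum (λ b → f I (β b) a * g I (β b) b) ≡ sum (λ J → f I J a * G I J)
  inner I a = trans (sum-fibres β _) (sum-cong λ J → begin
    sum (λ b → 𝟙 (β b ≟ J) * (f I (β b) a * g I (β b) b))
      ≡⟨ sum-cong (λ b → 𝟙-≡-subst (β b ≟ J) (λ J → f I J a * g I J b)) ⟩
    sum (λ b → 𝟙 (β b ≟ J) * (f I J a * g I J b))
      ≡⟨ sum-cong (λ b → solve 3 (λ u v w → u :* (v :* w) := v :* (u :* w)) refl (𝟙 (β b ≟ J)) (f I J a) (g I J b)) ⟩
    sum (λ b → f I J a * (𝟙 (β b ≟ J) * g I J b))
      ≡⟨ sum-* (f I J a) _ ⟨
    f I J a * G I J ∎)

module Traces {n m p : ℕ} (x z : Fin m → Fin n) (α : Fin n → Fin p) (H : ℕ) where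

  Nbr : Fin n → Fin n → Set
  Nbr c a = ∃[ e ] x e ≡ a × z e ≡ c

  nbr? : ∀ c → Decidable (Nbr c)
  nbr? c a = Fin.any? λ e → x e ≟ a ×-dec z e ≟ c

  atom : Fin p → ℕ
  atom I = sum (λ a → 𝟙 (α a ≟ I) * 1)

  trace : Fin n → Fin p → ℕ
  trace c I = sum (λ a → 𝟙 (α a ≟ I) * 𝟙 (nbr? c a))

  Rich : Fin n → Fin p → Set
  Rich c I = atom I ≤ H * trace c I

  rich? : ∀ c → Decidable (Rich c)
  rich? c I = atom I ≤? H * trace c I

  -- For fixed c, an atom that is not rich contains less than 1/H of its size in neighbours of c.
  -- Summing over the atoms gives at most n/H such neighbours, and summing over c gives n²/H.
  poor-≤ : PairInjective z x → H * # (λ i → ¬? (rich? (z i) (α (x i)))) ≤ n * n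
  poor-≤ inj = begin
    H * # (λ i → ¬? (rich? (z i) (α (x i))))
      ≡⟨ cong (H *_) (sum-cong λ i → sym (trans
           (cong (_* poor (z i) (α (x i))) (𝟙-yes (nbr? (z i) (x i)) (i , refl , refl))) (*-identityˡ _))) ⟩
    H * sum (λ i → 𝟙 (nbr? (z i) (x i)) * poor (z i) (α (x i)))
      ≤⟨ *-monoʳ-≤ H (sum-pairs z x inj (λ c a → 𝟙 (nbr? c a) * poor c (α a))) ⟩
    H * sum (λ c → sum (λ a → 𝟙 (nbr? c a) * poor c (α a)))
      ≡⟨ sum-* H _ ⟩
    sum (λ c → H * sum (λ a → 𝟙 (nbr? c a) * poor c (α a)))
      ≤⟨ sum-≤-const n per-vertex ⟩
    n * n ∎
    where
    open ≤-Reasoning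
    poor : Fin n → Fin p → ℕ
    poor c I = 𝟙 (¬? (rich? c I))
    poor-trace : ∀ c I (d : Dec (Rich c I)) → H * (𝟙 (¬? d) * trace c I) ≤ atom I
    poor-trace c I d@(yes r) = ≤-trans (≤-reflexive
      (trans (cong (λ t → H * (t * trace c I)) (𝟙-no (¬? d) λ ¬r → ¬r r)) (*-zeroʳ H))) z≤n
    poor-trace c I d@(no ¬r) = ≤-trans (≤-reflexive
      (cong (H *_) (trans (cong (_* trace c I) (𝟙-yes (¬? d) ¬r)) (*-identityˡ _)))) (<⇒≤ (≰⇒> ¬r))
    per-vertex : ∀ c → H * sum (λ a → 𝟙 (nbr? c a) * poor c (α a)) ≤ n
    per-vertex c = begin
      H * sum (λ a → 𝟙 (nbr? c a) * poor c (α a))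
        ≡⟨ cong (H *_) (sum-fibres α _) ⟩
      H * sum (λ I → sum (λ a → 𝟙 (α a ≟ I) * (𝟙 (nbr? c a) * poor c (α a))))
        ≡⟨ cong (H *_) (sum-cong λ I → trans
             (sum-cong λ a → trans (𝟙-≡-subst (α a ≟ I) (λ I → 𝟙 (nbr? c a) * poor c I))
               (solve 3 (λ u v w → u :* (v :* w) := w :* (u :* v)) refl (𝟙 (α a ≟ I)) (𝟙 (nbr? c a)) (poor c I)))
             (sym (sum-* (poor c I) _))) ⟩
      H * sum (λ I → poor c I * trace c I)
        ≡⟨ sum-* H _ ⟩
      sum (λ I → H * (poor c I * trace c I))
        ≤⟨ sum-mono (λ I → poor-trace c I (rich? c I)) ⟩
      sum atom
        ≡⟨ sum-fibres α (λ _ → 1) ⟨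
      sum {n} (λ _ → 1)
        ≡⟨ trans (sum-const n 1) (*-identityʳ n) ⟩
      n ∎

-- Linear triple systems

-- A round cuts one product out of each of the p² cells. An atom is met by p of them, so p bits, one
-- for each atom of the other side, describe its refinement.
tower : ℕ → ℕ
tower zero    = 1
tower (suc t) = tower t * 2 ^ tower t

tower-≥1 : ∀ t → 1 ≤ tower t
tower-≥1 zero    = ≤-refl
tower-≥1 (suc t) = *-mono-≤ (tower-≥1 t) (m^n>0 2 (tower t))

tower-mono : ∀ {s t} → s ≤ t → tower s ≤ tower t
tower-mono {s} s≤t = go (≤⇒≤′ s≤t)
  where
  go : ∀ {t} → s ≤′ t → tower s ≤ tower t
  go ≤′-refl = ≤-refl
  go (≤′-step {t} le) = ≤-trans (go le)
    (≤-trans (≤-reflexive (sym (*-identityʳ (tower t)))) (*-monoʳ-≤ (tower t) (m^n>0 2 (tower t))))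

-- Of the at least n²/k triples, marked pairs and good third vertices take at most n²/c each, poor
-- traces at most n²/H on each side. With `c = 4k` and `H = 8k` this leaves n²/(4k) triples, hence
-- active cells of area at least n²/c. Marking a product of proportion at least 1/H² in each of them
-- gains n²/`gain`, so `suc gain` rounds exceed n². Each round may add n²/(c · `steps`) marked
-- edges, which keeps their total below n²/c. The at most `PB * PB` cells contribute at most 2n²/K
-- each once `K ≤ n`, and this determines K.
record Constants (k : ℕ) : Set where
  field
    c H gain steps PB K : ℕ
    c≡       : c ≡ 4 * k
    H≡       : H ≡ 8 * k
    gain≡    : gain ≡ c * (H * H)
    steps≡   : steps ≡ suc gain
    1≤PB     : 1 ≤ PB
    tower≤PB : ∀ {t} → t ≤ steps → tower t ≤ PB
    K≡       : K ≡ 2 * (PB * PB) * (c * steps)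
    1≤K      : 1 ≤ K

opaque
  constants : (k : ℕ) → 1 ≤ k → Constants k
  constants k 1≤k = record
    { c = c ; H = H ; gain = gain ; steps = steps ; PB = tower steps ; K = 2 * (tower steps * tower steps) * (c * steps)
    ; c≡ = refl ; H≡ = refl ; gain≡ = refl ; steps≡ = refl
    ; 1≤PB = tower-≥1 steps ; tower≤PB = tower-mono ; K≡ = refl
    ; 1≤K = positive (tower steps) c steps (tower-≥1 steps) (*-mono-≤ {1} {4} (s≤s z≤n) 1≤k) (s≤s z≤n) }
    where
    c H gain steps : ℕ
    c = 4 * k
    H = 8 * k
    gain = c * (H * H)
    steps = suc gain
    positive : ∀ p c s → 1 ≤ p → 1 ≤ c → 1 ≤ s → 1 ≤ 2 * (p * p) * (c * s)
    positive p c s 1≤p 1≤c 1≤s = *-mono-≤ {1} {2 * (p * p)}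
      (*-mono-≤ {1} {2} (s≤s z≤n) (*-mono-≤ 1≤p 1≤p)) (*-mono-≤ 1≤c 1≤s)

module Links {n m : ℕ} (x y z : Fin m → Fin n) where

  -- c forms a triangle with the pair (x i , y i), but not the triple i.
  Link : Fin n → Fin m → Set
  Link c i = (∃[ e ] x e ≡ x i × z e ≡ c) × (∃[ e ] y e ≡ y i × z e ≡ c) × z i ≢ c

  link? : ∀ c → Decidable (Link c)
  link? c i =
    Fin.any? (λ e → x e ≟ x i ×-dec z e ≟ c) ×-dec
    Fin.any? (λ e → y e ≟ y i ×-dec z e ≟ c) ×-dec ¬? (z i ≟ c)

module TripleSystem {n m : ℕ} (x y z : Fin m → Fin n)
  (xy-inj : PairInjective x y) (zx-inj : PairInjective z x) (zy-inj : PairInjective z y)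
  (k : ℕ) (dense : n * n ≤ k * m)
  (C : Constants k) where

  open Constants C
  open Links x y z
  open ≤-Reasoning

  Good : Fin n → Set
  Good c = n * n ≤ K * # (link? c)

  good? : Decidable Good
  good? c = n * n ≤? K * # (link? c)

  -- Both copies of the vertex set are partitioned into p atoms, and W is a
  -- union of products of atoms; t rounds have marked much area but few edges.
  record State (t : ℕ) : Set₁ where
    field
      p          : ℕ
      p≤         : p ≤ tower t
      α β        : Fin n → Fin p
      W          : Fin n → Fin n → Set
      W?         : ∀ a b → Dec (W a b)
      measurable : ∀ {a a′ b b′} → α a ≡ α a′ → β b ≡ β b′ → W a b → W a′ b′
      few-edges  : c * steps * # (λ i → W? (x i) (y i)) ≤ t * (n * n)
      large-area : t * (n * n) ≤ gain * sum (λ a → # (W? a))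

  initial : State 0
  initial = record
    { p = 1 ; p≤ = ≤-refl ; α = λ _ → zero ; β = λ _ → zero
    ; W = λ _ _ → ⊥ ; W? = λ _ _ → no λ () ; measurable = λ _ _ ()
    ; few-edges = ≤-reflexive (trans (cong (c * steps *_) (sum-zero {m} λ _ → 𝟙-no (no λ ()) λ ()))
        (*-zeroʳ (c * steps)))
    ; large-area = z≤n }

  module Step (M : ℕ) (few-good : # good? ≤ M) (4kM≤n : c * M ≤ n) (K≤n : K ≤ n)
    {t : ℕ} (t<steps : t < steps) (σ : State t) where
    open State σ
    private
      module X = Traces x z α H
      module Y = Traces y z β H

    -- One witness serves the whole cell: the product of the traces of `z i` is cut out of it.
    -- Richness makes that product large, `¬ Good` makes its edges few, and by measurability a
    -- single unmarked pair makes the whole cell unmarked.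
    Active : Fin p → Fin p → Fin m → Set
    Active I J i = (α (x i) ≡ I × β (y i) ≡ J) × ¬ W (x i) (y i) ×
      X.Rich (z i) I × Y.Rich (z i) J × ¬ Good (z i)

    active? : ∀ I J → Dec (∃ (Active I J))
    active? I J = Fin.any? λ i → (α (x i) ≟ I ×-dec β (y i) ≟ J) ×-dec ¬? (W? (x i) (y i)) ×-dec
      X.rich? (z i) I ×-dec Y.rich? (z i) J ×-dec ¬? (good? (z i))

    module _ {I J : Fin p} where
      -- The vertex is read off the decision for the cell, so all points of the cell are cut by the
      -- neighbourhoods of the same vertex.
      XCut YCut : Dec (∃ (Active I J)) → Fin n → Set
      XCut (yes (i , _)) a = X.Nbr (z i) a
      XCut (no _)        a = ⊥
      YCut (yes (i , _)) b = Y.Nbr (z i) b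
      YCut (no _)        b = ⊥

      xcut? : ∀ d → Decidable (XCut d)
      xcut? (yes (i , _)) a = X.nbr? (z i) a
      xcut? (no _)        a = no λ ()
      ycut? : ∀ d → Decidable (YCut d)
      ycut? (yes (i , _)) b = Y.nbr? (z i) b
      ycut? (no _)        b = no λ ()

    R : Fin n → Fin n → Set
    R a b = XCut (active? (α a) (β b)) a × YCut (active? (α a) (β b)) b

    R? : ∀ a b → Dec (R a b)
    R? a b = xcut? (active? (α a) (β b)) a ×-dec ycut? (active? (α a) (β b)) b

    α′ β′ : Fin n → Fin (p * 2 ^ p)
    α′ a = combine (α a) (bits (λ J → xcut? (active? (α a) J) a))
    β′ b = combine (β b) (bits (λ I → ycut? (active? I (β b)) b))

    W′ : Fin n → Fin n → Set
    W′ a b = W a b ⊎ R a b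

    measurable′ : ∀ {a a′ b b′} → α′ a ≡ α′ a′ → β′ b ≡ β′ b′ → W′ a b → W′ a′ b′
    measurable′ {a} {a′} {b} {b′} eqα eqβ = λ
      { (inj₁ w) → inj₁ (measurable αa βb w)
      ; (inj₂ (u , v)) → inj₂
        ( subst (λ J → XCut (active? (α a′) J) a′) βb
            (bits-transfer (λ J → xcut? (active? (α a) J) a) (λ J → xcut? (active? (α a′) J) a′) xbits (β b) u)
        , subst (λ I → YCut (active? I (β b′)) b′) αa
            (bits-transfer (λ I → ycut? (active? I (β b)) b) (λ I → ycut? (active? I (β b′)) b′) ybits (α a) v)) }
      where
      αa    = Fin.combine-injectiveˡ (α a) _ (α a′) _ eqα
      xbits = Fin.combine-injectiveʳ (α a) _ (α a′) _ eqα
      βb    = Fin.combine-injectiveˡ (β b) _ (β b′) _ eqβ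
      ybits = Fin.combine-injectiveʳ (β b) _ (β b′) _ eqβ

    disjoint : ∀ a b → W a b → ¬ R a b
    disjoint a b w r = by-cases (active? (α a) (β b)) (proj₁ r)
      where
      by-cases : (d : Dec (∃ (Active (α a) (β b)))) → ¬ XCut d a
      by-cases (yes (_ , (αx , βy) , ¬w , _)) _ = ¬w (measurable (sym αx) (sym βy) w)

    active-area : ℕ
    active-area = sum (λ a → sum (λ b → 𝟙 (active? (α a) (β b)) * 1))

    active-area-≤ : active-area ≤ H * H * sum (λ a → # (R? a))
    active-area-≤ = begin
      active-area
        ≡⟨ product-fibres α β (λ I J _ → 𝟙 (active? I J)) (λ _ _ _ → 1) ⟩
      sum (λ I → sum (λ J → sum (λ a → 𝟙 (α a ≟ I) * 𝟙 (active? I J)) * Y.atom J))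
        ≤⟨ sum-mono (λ I → sum-mono λ J → cell I J (active? I J)) ⟩
      sum (λ I → sum (λ J → H * H * cut I J (active? I J)))
        ≡⟨ sum-cong (λ I → sym (sum-* (H * H) _)) ⟩
      sum (λ I → H * H * sum (λ J → cut I J (active? I J)))
        ≡⟨ sum-* (H * H) _ ⟨
      H * H * sum (λ I → sum (λ J → cut I J (active? I J)))
        ≡⟨ cong (H * H *_) (product-fibres α β (λ I J a → 𝟙 (xcut? (active? I J) a)) (λ I J b → 𝟙 (ycut? (active? I J) b))) ⟨
      H * H * sum (λ a → sum (λ b → 𝟙 (xcut? (active? (α a) (β b)) a) * 𝟙 (ycut? (active? (α a) (β b)) b)))
        ≡⟨ cong (H * H *_) (sum-cong λ a → sum-cong λ b →
             sym (𝟙-× (xcut? (active? (α a) (β b)) a) (ycut? (active? (α a) (β b)) b))) ⟩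
      H * H * sum (λ a → # (R? a)) ∎
      where
      cut : ∀ I J → Dec (∃ (Active I J)) → ℕ
      cut I J d = sum (λ a → 𝟙 (α a ≟ I) * 𝟙 (xcut? d a)) * sum (λ b → 𝟙 (β b ≟ J) * 𝟙 (ycut? d b))
      cell : ∀ I J (d : Dec (∃ (Active I J))) →
        sum (λ a → 𝟙 (α a ≟ I) * 𝟙 d) * Y.atom J ≤ H * H * cut I J d
      cell I J d@(no ¬act) = ≤-trans (≤-reflexive (cong (_* Y.atom J)
        (sum-zero λ a → trans (cong (𝟙 (α a ≟ I) *_) (𝟙-no d ¬act)) (*-zeroʳ (𝟙 (α a ≟ I)))))) z≤n
      cell I J d@(yes act@(i , _ , _ , richX , richY , _)) = begin
        sum (λ a → 𝟙 (α a ≟ I) * 𝟙 d) * Y.atom J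
          ≡⟨ cong (_* Y.atom J) (sum-cong λ a → cong (𝟙 (α a ≟ I) *_) (𝟙-yes d act)) ⟩
        X.atom I * Y.atom J
          ≤⟨ *-mono-≤ richX richY ⟩
        H * X.trace (z i) I * (H * Y.trace (z i) J)
          ≡⟨ solve 3 (λ h u v → h :* u :* (h :* v) := h :* h :* (u :* v)) refl H (X.trace (z i) I) (Y.trace (z i) J) ⟩
        H * H * (X.trace (z i) I * Y.trace (z i) J) ∎

    -- A vertex c that is not good spans few edges between its two
    -- neighbourhoods, apart from the at most n edges it forms triples with.
    cut-edges-≤ : K * # (λ i → R? (x i) (y i)) ≤ p * (p * (n * n + K * n))
    cut-edges-≤ = begin
      K * # (λ i → R? (x i) (y i))
        ≡⟨ cong (K *_) (trans (sum-fibres (α ∘ x) _) (sum-cong λ I → sum-fibres (β ∘ y) _)) ⟩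
      K * sum (λ I → sum (λ J → cell I J))
        ≡⟨ trans (sum-* K _) (sum-cong λ I → sum-* K _) ⟩
      sum (λ I → sum (λ J → K * cell I J))
        ≤⟨ sum-≤-const _ (λ I → sum-≤-const _ λ J → cell-≤ I J) ⟩
      p * (p * (n * n + K * n)) ∎
      where
      cell : Fin p → Fin p → ℕ
      cell I J = sum (λ i → 𝟙 (β (y i) ≟ J) * (𝟙 (α (x i) ≟ I) * 𝟙 (R? (x i) (y i))))
      at-vertex : ∀ c → # (λ i → z i ≟ c) ≤ n
      at-vertex c = begin
        # (λ i → z i ≟ c)                ≤⟨ sum-pairs z x zx-inj (λ b _ → 𝟙 (b ≟ c)) ⟩
        sum (λ b → sum {n} (λ _ → 𝟙 (b ≟ c))) ≡⟨ sum-comm {m = n} {n = n} (λ b _ → 𝟙 (b ≟ c)) ⟩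
        sum {n} (λ _ → # (_≟ c))         ≤⟨ sum-≤-const 1 (λ _ → #-unique (_≟ c) λ i j p q → trans p (sym q)) ⟩
        n * 1                            ≡⟨ *-identityʳ n ⟩
        n                                ∎
      cut-≤ : ∀ {I J} (d : Dec (∃ (Active I J))) →
        K * # (λ i → xcut? d (x i) ×-dec ycut? d (y i)) ≤ n * n + K * n
      cut-≤ d@(no _) = ≤-trans (≤-reflexive (trans (cong (K *_)
        (sum-zero {m} λ i → 𝟙-no (xcut? d (x i) ×-dec ycut? d (y i)) proj₁)) (*-zeroʳ K))) z≤n
      cut-≤ d@(yes (i₀ , _ , _ , _ , _ , ¬good)) = begin
        K * # (λ i → xcut? d (x i) ×-dec ycut? d (y i))
          ≤⟨ *-monoʳ-≤ K (#-⊆-∪ _ (link? (z i₀)) (λ i → z i ≟ z i₀) λ i (u , v) →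
               case z i ≟ z i₀ of λ { (yes eq) → inj₂ eq ; (no neq) → inj₁ (u , v , neq) }) ⟩
        K * (# (link? (z i₀)) + # (λ i → z i ≟ z i₀))
          ≡⟨ *-distribˡ-+ K (# (link? (z i₀))) _ ⟩
        K * # (link? (z i₀)) + K * # (λ i → z i ≟ z i₀)
          ≤⟨ +-mono-≤ (<⇒≤ (≰⇒> ¬good)) (*-monoʳ-≤ K (at-vertex (z i₀))) ⟩
        n * n + K * n ∎
      cell-≤ : ∀ I J → K * cell I J ≤ n * n + K * n
      cell-≤ I J = ≤-trans (*-monoʳ-≤ K (sum-mono λ i → begin
        𝟙 (β (y i) ≟ J) * (𝟙 (α (x i) ≟ I) * 𝟙 (R? (x i) (y i)))
          ≡⟨ cong (λ t → 𝟙 (β (y i) ≟ J) * t)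
               (𝟙-≡-subst (α (x i) ≟ I) (λ I → 𝟙 (xcut? (active? I (β (y i))) (x i) ×-dec ycut? (active? I (β (y i))) (y i)))) ⟩
        𝟙 (β (y i) ≟ J) * (𝟙 (α (x i) ≟ I) * 𝟙 (xcut? (active? I (β (y i))) (x i) ×-dec ycut? (active? I (β (y i))) (y i)))
          ≡⟨ 𝟙-≡-subst (β (y i) ≟ J) (λ J → 𝟙 (α (x i) ≟ I) * 𝟙 (xcut? (active? I J) (x i) ×-dec ycut? (active? I J) (y i))) ⟩
        𝟙 (β (y i) ≟ J) * (𝟙 (α (x i) ≟ I) * 𝟙 (xcut? (active? I J) (x i) ×-dec ycut? (active? I J) (y i)))
          ≤⟨ ≤-trans (*-monoˡ-≤ _ (𝟙≤1 (β (y i) ≟ J))) (≤-trans (≤-reflexive (*-identityˡ _))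
               (≤-trans (*-monoˡ-≤ _ (𝟙≤1 (α (x i) ≟ I))) (≤-reflexive (*-identityˡ _)))) ⟩
        𝟙 (xcut? (active? I J) (x i) ×-dec ycut? (active? I J) (y i)) ∎))
        (cut-≤ (active? I J))

    w-edges poorX poorY good-edges active-edges : ℕ
    w-edges      = # (λ i → W? (x i) (y i))
    poorX        = # (λ i → ¬? (X.rich? (z i) (α (x i))))
    poorY        = # (λ i → ¬? (Y.rich? (z i) (β (y i))))
    good-edges   = # (λ i → good? (z i))
    active-edges = # (λ i → active? (α (x i)) (β (y i)))

    -- A triple that is in none of the first four classes is itself a witness that its cell is
    -- active.
    edges-≤ : m ≤ w-edges + (poorX + (poorY + (good-edges + active-edges)))
    edges-≤ = begin
      m                      ≡⟨ trans (sum-const m 1) (*-identityʳ m) ⟨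
      sum {m} (λ _ → 1)      ≡⟨ sum-cong {m} (λ _ → sym (𝟙-yes (yes tt) tt)) ⟩
      # {m} {λ _ → ⊤} (λ _ → yes tt)  ≤⟨ #-⊆-∪ _ w? (λ i → px? i ⊎-dec py? i ⊎-dec g? i ⊎-dec a? i) (λ i _ → cover i) ⟩
      w-edges + # (λ i → px? i ⊎-dec py? i ⊎-dec g? i ⊎-dec a? i)
        ≤⟨ +-monoʳ-≤ w-edges (≤-trans (#-⊆-∪ _ px? (λ i → py? i ⊎-dec g? i ⊎-dec a? i) (λ _ → id))
             (+-monoʳ-≤ poorX (≤-trans (#-⊆-∪ _ py? (λ i → g? i ⊎-dec a? i) (λ _ → id))
               (+-monoʳ-≤ poorY (#-⊆-∪ _ g? a? (λ _ → id)))))) ⟩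
      w-edges + (poorX + (poorY + (good-edges + active-edges))) ∎
      where
      w? = λ i → W? (x i) (y i)
      px? = λ i → ¬? (X.rich? (z i) (α (x i)))
      py? = λ i → ¬? (Y.rich? (z i) (β (y i)))
      g? = λ i → good? (z i)
      a? = λ i → active? (α (x i)) (β (y i))
      cover : ∀ i → W (x i) (y i) ⊎ ¬ X.Rich (z i) (α (x i)) ⊎ ¬ Y.Rich (z i) (β (y i)) ⊎
        Good (z i) ⊎ ∃ (Active (α (x i)) (β (y i)))
      cover i = classify (W? (x i) (y i)) (X.rich? (z i) (α (x i))) (Y.rich? (z i) (β (y i))) (good? (z i))
        where
        classify : Dec (W (x i) (y i)) → Dec (X.Rich (z i) (α (x i))) → Dec (Y.Rich (z i) (β (y i))) →
          Dec (Good (z i)) → _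
        classify (yes w) _       _       _       = inj₁ w
        classify (no ¬w) (no ¬u) _       _       = inj₂ (inj₁ ¬u)
        classify (no ¬w) (yes u) (no ¬v) _       = inj₂ (inj₂ (inj₁ ¬v))
        classify (no ¬w) (yes u) (yes v) (yes g) = inj₂ (inj₂ (inj₂ (inj₁ g)))
        classify (no ¬w) (yes u) (yes v) (no ¬g) = inj₂ (inj₂ (inj₂ (inj₂ (i , (refl , refl) , ¬w , u , v , ¬g))))

    good-edges-≤ : c * good-edges ≤ n * n
    good-edges-≤ = begin
      c * good-edges        ≤⟨ *-monoʳ-≤ (c) (sum-pairs z x zx-inj (λ c _ → 𝟙 (good? c))) ⟩
      c * sum (λ c → sum {n} (λ _ → 𝟙 (good? c)))
        ≡⟨ cong (c *_) (trans (sum-comm {m = n} {n = n} (λ c _ → 𝟙 (good? c))) (sum-const n (# good?))) ⟩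
      c * (n * # good?)     ≤⟨ *-monoʳ-≤ (c) (*-monoʳ-≤ n few-good) ⟩
      c * (n * M)           ≡⟨ solve 3 (λ a b c → a :* (b :* c) := a :* c :* b) refl c n M ⟩
      c * M * n             ≤⟨ *-monoˡ-≤ n 4kM≤n ⟩
      n * n                     ∎

    w-edges-≤ : c * w-edges ≤ n * n
    w-edges-≤ = *-cancelˡ-≤ steps {{>-nonZero (≤-<-trans z≤n t<steps)}} (begin
      steps * (c * w-edges) ≡⟨ solve 3 (λ a b c → a :* (b :* c) := b :* a :* c) refl steps (c) w-edges ⟩
      c * steps * w-edges   ≤⟨ few-edges ⟩
      t * (n * n)               ≤⟨ *-monoˡ-≤ (n * n) (<⇒≤ t<steps) ⟩
      steps * (n * n)           ∎)

    -- Distinct triples have distinct pairs, so an area is at least the number of edges in it. This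
    -- turns the abundance of remaining triples into area.
    active-edges-≤ : active-edges ≤ active-area
    active-edges-≤ = ≤-trans
      (≤-reflexive (sum-cong λ i → sym (*-identityʳ _)))
      (sum-pairs x y xy-inj (λ a b → 𝟙 (active? (α a) (β b)) * 1))

    n²≤active-area : n * n ≤ c * active-area
    -- Scaled to 8n², the losses are 2n² for marked pairs, n² for poor traces on each side and 2n²
    -- for good vertices: 6n² in all.
    n²≤active-area = *-cancelˡ-≤ 2 (+-cancelˡ-≤ (6 * (n * n)) _ _ (begin
      6 * (n * n) + 2 * (n * n)
        ≡⟨ solve 1 (λ q → con 6 :* q :+ con 2 :* q := con 8 :* q) refl (n * n) ⟩
      8 * (n * n)
        ≤⟨ *-monoʳ-≤ 8 (≤-trans dense (*-monoʳ-≤ k edges-≤)) ⟩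
      8 * (k * (w-edges + (poorX + (poorY + (good-edges + active-edges)))))
        ≡⟨ expand w-edges poorX poorY good-edges active-edges ⟩
      2 * (c * w-edges) + H * poorX + H * poorY + 2 * (c * good-edges) + 2 * (c * active-edges)
        ≤⟨ +-mono-≤ (+-mono-≤ (+-mono-≤ (+-mono-≤ (*-monoʳ-≤ 2 w-edges-≤) (X.poor-≤ zx-inj)) (Y.poor-≤ zy-inj))
             (*-monoʳ-≤ 2 good-edges-≤)) (*-monoʳ-≤ 2 (*-monoʳ-≤ (c) active-edges-≤)) ⟩
      2 * (n * n) + n * n + n * n + 2 * (n * n) + 2 * (c * active-area)
        ≡⟨ solve 2 (λ q a → con 2 :* q :+ q :+ q :+ con 2 :* q :+ con 2 :* a := con 6 :* q :+ con 2 :* a)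
             refl (n * n) (c * active-area) ⟩
      6 * (n * n) + 2 * (c * active-area) ∎))

      where
      expand : ∀ w u v g a → 8 * (k * (w + (u + (v + (g + a))))) ≡
        2 * (c * w) + H * u + H * v + 2 * (c * g) + 2 * (c * a)
      expand rewrite c≡ | H≡ = solve 6 (λ k w u v g a → con 8 :* (k :* (w :+ (u :+ (v :+ (g :+ a)))))
             := con 2 :* (con 4 :* k :* w) :+ con 8 :* k :* u :+ con 8 :* k :* v :+ con 2 :* (con 4 :* k :* g)
                :+ con 2 :* (con 4 :* k :* a)) refl k

    area′-≥ : suc t * (n * n) ≤ gain * sum (λ a → # (λ b → W? a b ⊎-dec R? a b))
    area′-≥ = begin
      n * n + t * (n * n)
        ≤⟨ +-mono-≤ n²≤active-area large-area ⟩
      c * active-area + gain * area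
        ≤⟨ +-monoˡ-≤ _ (*-monoʳ-≤ (c) active-area-≤) ⟩
      c * (H * H * cut) + gain * area
        ≡⟨ cong (_+ gain * area) (trans (sym (*-assoc c (H * H) cut)) (cong (_* cut) (sym gain≡))) ⟩
      gain * cut + gain * area
        ≡⟨ trans (+-comm (gain * cut) _) (sym (*-distribˡ-+ gain area cut)) ⟩
      gain * (area + cut)
        ≡⟨ cong (gain *_) (trans (sum-+ (λ a → # (W? a)) _) refl) ⟨
      gain * sum (λ a → # (W? a) + # (R? a))
        ≡⟨ cong (gain *_) (sum-cong λ a → sum-+ (λ b → 𝟙 (W? a b)) _) ⟨
      gain * sum (λ a → sum (λ b → 𝟙 (W? a b) + 𝟙 (R? a b)))
        ≤⟨ *-monoʳ-≤ gain (sum-mono λ a → sum-mono λ b →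
             𝟙-+-≤ (W? a b) (R? a b) (W? a b ⊎-dec R? a b) inj₁ inj₂ (disjoint a b)) ⟩
      gain * sum (λ a → # (λ b → W? a b ⊎-dec R? a b)) ∎
      where
      area = sum (λ a → # (W? a))
      cut  = sum (λ a → # (R? a))

    p≤PB : p ≤ PB
    p≤PB = ≤-trans p≤ (tower≤PB (<⇒≤ t<steps))

    K-assoc : ∀ e → K * e ≡ 2 * (PB * PB) * (c * steps * e)
    K-assoc e = trans (cong (_* e) K≡) (*-assoc (2 * (PB * PB)) (c * steps) e)

    edges′-≤ : c * steps * # (λ i → W? (x i) (y i) ⊎-dec R? (x i) (y i)) ≤ suc t * (n * n)
    edges′-≤ = *-cancelˡ-≤ (2 * (PB * PB)) {{>-nonZero (*-mono-≤ {1} {2} (s≤s z≤n) (*-mono-≤ 1≤PB 1≤PB))}} (begin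
      2 * (PB * PB) * (c * steps * # (λ i → W? (x i) (y i) ⊎-dec R? (x i) (y i)))
        ≡⟨ K-assoc _ ⟨
      K * # (λ i → W? (x i) (y i) ⊎-dec R? (x i) (y i))
        ≤⟨ *-monoʳ-≤ K (#-⊆-∪ _ (λ i → W? (x i) (y i)) (λ i → R? (x i) (y i)) (λ _ → id)) ⟩
      K * (w-edges + # (λ i → R? (x i) (y i)))
        ≡⟨ *-distribˡ-+ K w-edges _ ⟩
      K * w-edges + K * # (λ i → R? (x i) (y i))
        ≤⟨ +-mono-≤ (≤-trans (≤-reflexive (K-assoc w-edges)) (*-monoʳ-≤ (2 * (PB * PB)) few-edges))
             (≤-trans cut-edges-≤ (*-mono-≤ p≤PB (*-mono-≤ p≤PB (+-monoʳ-≤ (n * n) (*-monoˡ-≤ n K≤n))))) ⟩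
      2 * (PB * PB) * (t * (n * n)) + PB * (PB * (n * n + n * n))
        ≡⟨ solve 3 (λ b t q → con 2 :* (b :* b) :* (t :* q) :+ b :* (b :* (q :+ q))
             := con 2 :* (b :* b) :* (q :+ t :* q)) refl PB t (n * n) ⟩
      2 * (PB * PB) * (suc t * (n * n)) ∎)

    next : State (suc t)
    next = record
      { p = p * 2 ^ p ; p≤ = *-mono-≤ p≤ (^-monoʳ-≤ 2 p≤) ; α = α′ ; β = β′
      ; W = W′ ; W? = λ a b → W? a b ⊎-dec R? a b
      ; measurable = λ {a} {a′} {b} {b′} → measurable′ {a} {a′} {b} {b′}
      ; few-edges = edges′-≤ ; large-area = area′-≥ }

  -- Otherwise the marked area would grow beyond n².
  many-good : (M : ℕ) → 1 ≤ n → c * M ≤ n → K ≤ n → M ≤ # good?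
  many-good M 1≤n 4kM≤n K≤n = ≮⇒≥ λ few → <-irrefl refl (begin-strict
    steps * (n * n)  ≤⟨ State.large-area (final few) ⟩
    gain * sum (λ a → # (State.W? (final few) a)) ≤⟨ *-monoʳ-≤ gain (sum-≤-const n (λ a → #-≤ (State.W? (final few) a))) ⟩
    gain * (n * n)   <⟨ m<n+m (gain * (n * n)) (*-mono-≤ 1≤n 1≤n) ⟩
    suc gain * (n * n) ≡⟨ cong (_* (n * n)) steps≡ ⟨
    steps * (n * n)  ∎)
    where
    reach : # good? < M → ∀ t → t ≤ steps → State t
    reach few zero    _  = initial
    reach few (suc t) le = Step.next M (<⇒≤ few) 4kM≤n K≤n le (reach few t (<⇒≤ le))
    final : # good? < M → State steps
    final few = reach few steps ≤-refl

-- Rainbow blow-ups of a triangle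

RainbowTripartite : {n m : ℕ} (s : ℕ) (x y z : Fin m → Fin n) → Set
RainbowTripartite {n} s x y z =
  ∃₂ λ (a b : Fin s → Fin n) → ∃ λ (c : Fin s → Fin n) →
  Injective _≡_ _≡_ a × Injective _≡_ _≡_ b × Injective _≡_ _≡_ c ×
  (∀ i j → ∃[ e ] x e ≡ a i × y e ≡ b j) ×
  (∀ i l → ∃[ e ] x e ≡ a i × z e ≡ c l) ×
  (∀ j l → ∃[ e ] y e ≡ b j × z e ≡ c l) ×
  (∀ e i j l → x e ≡ a i → y e ≡ b j → z e ≢ c l)

module _ {n m : ℕ} (s : ℕ) (x y z : Fin m → Fin n) (xy-inj : PairInjective x y) where

  open Links x y z

  -- By `dense-intersection`, s of the M vertices are linked to the same n²/K₂ pairs. A complete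
  -- bipartite graph formed by these pairs gives the first two parts and the s vertices give the
  -- third; links supply the edges to it. A triple on a base pair is the one that defines the pair,
  -- by `xy-inj`, and a link forbids it to contain the third vertex.
  rainbow-from-links : (K : ℕ) .{{_ : NonZero K}} →
    let M = suc s * K ; K₂ = M * 2 ^ M in
    kst-bound s K₂ ≤ n → M ≤ # (λ v → n * n ≤? K * # (link? v)) →
    RainbowTripartite s x y z
  rainbow-from-links K kst≤n M≤ = go₁ (choose _ M≤)
    where
    M = suc s * K
    K₂ = M * 2 ^ M
    instance
      M≢0 : NonZero M
      M≢0 = m*n≢0 (suc s) K
      K₂≢0 : NonZero K₂
      K₂≢0 = m*n≢0 M (2 ^ M) {{M≢0}} {{m^n≢0 2 M}}
    1≤n : 1 ≤ n
    1≤n = ≤-trans z<s kst≤n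

    go₃ : {g : Fin s → Fin n} → Injective _≡_ _≡_ g →
      {q : ℕ} {e : Fin q → Fin m} → (∀ i l → Link (g l) (e i)) →
      (∃₂ λ (a b : Fin s → Fin n) → Injective _≡_ _≡_ a × Injective _≡_ _≡_ b ×
        (∀ i j → ∃[ f ] x (e f) ≡ a i × y (e f) ≡ b j)) → RainbowTripartite s x y z
    go₃ {g} g-inj {q} {e} linked (a , b , a-inj , b-inj , ab) = a , b , g , a-inj , b-inj , g-inj ,
      (λ i j → e (base i j) , proj₂ (ab i j)) ,
      -- Any base pair through `a i` shows that `a i` is joined to `g l`; its partner `b i` is an
      -- arbitrary choice. The next line does the same for `b j`.
      (λ i l → let h , p , r = proj₁ (linked (base i i) l) in h , trans p (proj₁ (proj₂ (ab i i))) , r) ,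
      (λ j l → let h , p , r = proj₁ (proj₂ (linked (base j j) l)) in h , trans p (proj₂ (proj₂ (ab j j))) , r) ,
      λ h i j l p q r → proj₂ (proj₂ (linked (base i j) l)) (trans
        (cong z (xy-inj _ _ (trans (proj₁ (proj₂ (ab i j))) (sym p)) (trans (proj₂ (proj₂ (ab i j))) (sym q)))) r)
      where
      base : Fin s → Fin s → Fin q
      base i j = proj₁ (ab i j)

    go₂ : {g : Fin M → Fin n} → Injective _≡_ _≡_ g →
      (∃ λ (t : Fin s → Fin M) → Injective _≡_ _≡_ t ×
        ∃₂ λ q (e : Fin q → Fin m) → Injective _≡_ _≡_ e ×
        n * n ≤ K₂ * q × (∀ i l → Link (g (t l)) (e i))) → RainbowTripartite s x y z
    go₂ g-inj (t , t-inj , q , e , e-inj , n²≤q , linked) =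
      go₃ (λ eq → t-inj (g-inj eq)) linked
        (kővári–sós–turán s K₂ kst≤n (x ∘ e) (y ∘ e) (λ i j p q → e-inj (xy-inj _ _ p q)) n²≤q)

    go₁ : (∃ λ (g : Fin M → Fin n) → Injective _≡_ _≡_ g × ∀ j → n * n ≤ K * # (link? (g j))) →
      RainbowTripartite s x y z
    go₁ (g , g-inj , g-rich) =
      go₂ g-inj (dense-intersection s K (*-mono-≤ 1≤n 1≤n) (pairs-≤ x y xy-inj) (λ j → link? (g j)) g-rich)

opaque
  rainbow-bound : (s k : ℕ) → 1 ≤ k → ℕ
  rainbow-bound s k 1≤k = kst-bound s (suc s * K * 2 ^ (suc s * K)) + (c * (suc s * K) + K)
    where open Constants (constants k 1≤k)

  rainbow-tripartite : (s k : ℕ) (1≤k : 1 ≤ k) {n m : ℕ} (x y z : Fin m → Fin n) →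
    PairInjective x y → PairInjective z x → PairInjective z y →
    rainbow-bound s k 1≤k ≤ n → n * n ≤ k * m → RainbowTripartite s x y z
  rainbow-tripartite s k 1≤k {n} x y z xy zx zy N≤n dense =
    rainbow-from-links s x y z xy K {{>-nonZero 1≤K}} kst≤n
      (TripleSystem.many-good x y z xy zx zy k dense C (suc s * K) (≤-trans z<s kst≤n)
        (≤-trans (m≤m+n _ _) rest≤n) (≤-trans (m≤n+m _ (c * (suc s * K))) rest≤n))
    where
    C : Constants k
    C = constants k 1≤k
    open Constants C
    kst : ℕ
    kst = kst-bound s (suc s * K * 2 ^ (suc s * K))
    kst≤n : kst ≤ n
    kst≤n = ≤-trans (m≤m+n kst _) N≤n
    rest≤n : c * (suc s * K) + K ≤ n
    rest≤n = ≤-trans (m≤n+m (c * (suc s * K) + K) kst) N≤n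

-- Berge copies

codegree? : (𝓗 : Hypergraph n) (p q : Fin n) → Decidable (λ i → p ∈ edge 𝓗 i × q ∈ edge 𝓗 i)
codegree? 𝓗 p q i = p ∈? edge 𝓗 i ×-dec q ∈? edge 𝓗 i

record EdgeEnumeration {v : ℕ} (F : Graph v) : Set where
  field
    E         : ℕ
    to        : Edge F → Fin E
    from      : Fin E → Edge F
    from-to   : ∀ e → from (to e) ≡ e
    to-from   : ∀ j → to (from j) ≡ j

module _ {v : ℕ} (F : Graph v) where

  fst snd : Edge F → Fin v
  fst (u , _)     = u
  snd (_ , w , _) = w

  edge-≡ : (e e′ : Edge F) → fst e ≡ fst e′ → snd e ≡ snd e′ → e ≡ e′
  edge-≡ (u , w , u<w , a) (.u , .w , u<w′ , a′) refl refl =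
    cong₂ (λ p q → u , w , p , q) (Fin.<-irrelevant u<w u<w′) (T-irrelevant a a′)

  opaque
    edge-enumeration : EdgeEnumeration F
    edge-enumeration = record
      { E = # edge? ; to = to ; from = from
      ; from-to = λ e → edge-≡ _ _ (cong proj₁ (ends-to e)) (cong proj₂ (ends-to e))
      ; to-from = λ j → at-inj En (trans (proj₂ (index En _ _)) (Fin.combine-remQuot {v} v (at En j))) }
      where
      ends : Fin (v * v) → Fin v × Fin v
      ends = remQuot {v} v
      IsEdge : Fin v × Fin v → Set
      IsEdge (u , w) = u Fin.< w × Adj F u w
      edge? : Decidable (λ s → IsEdge (ends s))
      edge? s = proj₁ (ends s) Fin.<? proj₂ (ends s) ×-dec T? _
      En : Enumeration (λ s → IsEdge (ends s)) (# edge?)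
      En = enumerate edge?
      to : Edge F → Fin (# edge?)
      to (u , w , p) = proj₁ (index En (combine u w) (subst IsEdge (sym (Fin.remQuot-combine u w)) p))
      from : Fin (# edge?) → Edge F
      from j = _ , _ , at-∈ En j
      ends-to : ∀ e → ends (at En (to e)) ≡ (fst e , snd e)
      ends-to (u , w , p) = trans (cong ends (proj₂ (index En (combine u w) _))) (Fin.remQuot-combine u w)

  ¬BergeFree-from : {𝓗 : Hypergraph n} (φ : Fin v → Fin n) → Injective _≡_ _≡_ φ →
    (g : Edge F → Fin (size 𝓗)) → Injective _≡_ _≡_ g →
    (∀ e → φ (fst e) ∈ edge 𝓗 (g e) × φ (snd e) ∈ edge 𝓗 (g e)) → ¬ BergeFree F 𝓗
  ¬BergeFree-from {𝓗 = 𝓗} φ φ-inj g g-inj incident free = free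
    ( record
      { size     = E
      ; edge     = λ j → edge 𝓗 (g (from j))
      ; distinct = λ eq → from-inj (g-inj (Hypergraph.distinct 𝓗 eq)) }
    , (λ j → g (from j) , refl)
    , φ , φ-inj
    , mk⤖ ( (λ {e} {e′} eq → trans (sym (from-to e)) (trans (cong from eq) (from-to e′)))
          , (λ j → from j , λ { refl → to-from j }))
    , λ e → subst (λ e′ → φ (fst e) ∈ edge 𝓗 (g e′) × φ (snd e) ∈ edge 𝓗 (g e′)) (sym (from-to e)) (incident e) )
    where
    open EdgeEnumeration edge-enumeration
    from-inj : Injective _≡_ _≡_ from
    from-inj {j} {j′} eq = trans (sym (to-from j)) (trans (cong to eq) (to-from j′))

pick-avoiding : {a : ℕ} (avoid : Fin a → Fin m) {C : Fin m → Set} (C? : Decidable C) →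
  a < # C? → ∃[ i ] C i × ∀ b → i ≢ avoid b
pick-avoiding {m} {a} avoid {C} C? a<# with Fin.any? (λ i → C? i ×-dec Fin.all? (λ b → ¬? (i ≟ avoid b)))
... | yes p = p
... | no ¬p = contradiction a<# (≤⇒≯ (begin
  # C?                                          ≤⟨ sum-mono bound ⟩
  sum (λ i → # (λ b → avoid b ≟ i))             ≡⟨ sum-comm (λ i b → 𝟙 (avoid b ≟ i)) ⟩
  sum (λ b → # (avoid b ≟_))                    ≡⟨ sum-cong (λ b → #-single (avoid b)) ⟩
  sum {a} (λ _ → 1)                             ≡⟨ trans (sum-const a 1) (*-identityʳ a) ⟩
  a                                             ∎))
  where
  open ≤-Reasoning
  bound : ∀ i → 𝟙 (C? i) ≤ # (λ b → avoid b ≟ i)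
  bound i = by-cases (Fin.any? (λ b → avoid b ≟ i))
    where
    by-cases : Dec (∃[ b ] avoid b ≡ i) → 𝟙 (C? i) ≤ # (λ b → avoid b ≟ i)
    by-cases (yes (b , eq)) = ≤-trans (𝟙≤1 (C? i)) (≤-trans
      (≤-reflexive (sym (𝟙-yes (avoid b ≟ i) eq))) (term-≤-sum (λ b → 𝟙 (avoid b ≟ i)) b))
    by-cases (no ¬hit) = ≤-trans
      (≤-reflexive (𝟙-no (C? i) λ c → ¬p (i , c , λ b eq → ¬hit (b , sym eq)))) z≤n

-- Distinct representatives for the indices in `Need` only. The others keep a prescribed element,
-- and `avoid` lists the elements that are already taken.
record Representatives {E m a : ℕ} (avoid : Fin a → Fin m) (C : Fin E → Fin m → Set)
  (Need : Fin E → Set) (default : Fin E → Fin m) : Set where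
  field
    rep        : Fin E → Fin m
    rep-∈      : ∀ e → Need e → C e (rep e)
    rep-avoids : ∀ e → Need e → ∀ b → rep e ≢ avoid b
    rep-inj    : ∀ e e′ → Need e → Need e′ → rep e ≡ rep e′ → e ≡ e′
    rep-other  : ∀ e → ¬ Need e → rep e ≡ default e

open Representatives

-- Handling one index moves it from the E remaining ones to the a avoided ones, so the requirement
-- `a + E` is the same in every round.
greedy : {E m a : ℕ} (avoid : Fin a → Fin m) {C : Fin E → Fin m → Set} (C? : ∀ e → Decidable (C e))
  {Need : Fin E → Set} (need? : Decidable Need) (default : Fin E → Fin m) →
  (∀ e → Need e → a + E ≤ # (C? e)) → Representatives avoid C Need default
greedy {zero} avoid C? need? default large = record
  { rep = λ () ; rep-∈ = λ () ; rep-avoids = λ () ; rep-inj = λ () ; rep-other = λ () }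
greedy {suc E} {m} {a} avoid {C} C? {Need} need? default large = build (first (need? zero))
  where
  First : Set
  First = ∃[ i ] (Need zero → C zero i × ∀ b → i ≢ avoid b) × (¬ Need zero → i ≡ default zero)
  first : Dec (Need zero) → First
  first (yes n₀) = let i , c , av = pick-avoiding avoid (C? zero)
                         (≤-trans (s≤s (m≤m+n a E)) (≤-trans (≤-reflexive (sym (+-suc a E))) (large zero n₀)))
                   in i , (λ _ → c , av) , contradiction n₀
  first (no ¬n₀) = default zero , (λ n₀ → contradiction n₀ ¬n₀) , (λ _ → refl)
  build : First → Representatives avoid C Need default
  build (i₀ , good , other) = record
    { rep        = λ { zero → i₀ ; (suc e) → rep rest e }
    ; rep-∈      = λ { zero n → proj₁ (good n) ; (suc e) n → rep-∈ rest e n }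
    ; rep-avoids = λ { zero n → proj₂ (good n) ; (suc e) n b → rep-avoids rest e n (suc b) }
    ; rep-inj    = λ { zero zero _ _ _ → refl
                     ; zero (suc e) _ n eq → contradiction (sym eq) (rep-avoids rest e n zero)
                     ; (suc e) zero n _ eq → contradiction eq (rep-avoids rest e n zero)
                     ; (suc e) (suc e′) n n′ eq → cong suc (rep-inj rest e e′ n n′ eq) }
    ; rep-other  = λ { zero → other ; (suc e) → rep-other rest e } }
    where
    avoid′ : Fin (suc a) → Fin m
    avoid′ zero    = i₀
    avoid′ (suc b) = avoid b
    rest = greedy avoid′ (C? ∘ suc) (need? ∘ suc) (default ∘ suc)
      (λ e n → ≤-trans (≤-reflexive (sym (+-suc a E))) (large (suc e) n))

SamePair : (p q p′ q′ : Fin n) → Set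
SamePair p q p′ q′ = (p ≡ p′ × q ≡ q′) ⊎ (p ≡ q′ × q ≡ p′)

module _ {v n : ℕ} (F : Graph v) (𝓗 : Hypergraph n) where

  open EdgeEnumeration (edge-enumeration F)

  -- One E accounts for the hyperedges of the marked edges of F, the other for
  -- those already chosen by the greedy algorithm.
  Heavy : Fin n → Fin n → Set
  Heavy p q = E + E ≤ # (codegree? 𝓗 p q)

  heavy? : ∀ p q → Dec (Heavy p q)
  heavy? p q = E + E ≤? # (codegree? 𝓗 p q)

  heavy-sym : ∀ {p q} → Heavy p q → Heavy q p
  heavy-sym {p} {q} h = ≤-trans h (#-⊆ (codegree? 𝓗 p q) (codegree? 𝓗 q p) λ i (a , b) → b , a)

  -- A light edge of F uses the hyperedge that marks it; as a hyperedge marks a single pair, no two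
  -- light edges compete. The heavy edges then choose greedily, avoiding all these hyperedges and
  -- each other.
  ¬BergeFree-from-heavy-or-marked : Fin (size 𝓗) →
    {Mark : Fin (size 𝓗) → Fin n → Fin n → Set} →
    (∀ {i p q p′ q′} → Mark i p q → Mark i p′ q′ → SamePair p q p′ q′) →
    (φ : Fin v → Fin n) → Injective _≡_ _≡_ φ →
    (∀ e → Heavy (φ (fst F e)) (φ (snd F e)) ⊎
      ∃[ i ] (φ (fst F e) ∈ edge 𝓗 i × φ (snd F e) ∈ edge 𝓗 i) × Mark i (φ (fst F e)) (φ (snd F e))) →
    ¬ BergeFree F 𝓗
  ¬BergeFree-from-heavy-or-marked i₀ {Mark} mark-unique φ φ-inj placed =
    ¬BergeFree-from F {𝓗 = 𝓗} φ φ-inj (λ e → rep R (to e)) g-inj incident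
    where
    Marked : Edge F → Set
    Marked e = ∃[ i ] (φ (fst F e) ∈ edge 𝓗 i × φ (snd F e) ∈ edge 𝓗 i) × Mark i (φ (fst F e)) (φ (snd F e))
    HeavyE : Edge F → Set
    HeavyE e = Heavy (φ (fst F e)) (φ (snd F e))
    hyperedge : ∀ e → HeavyE e ⊎ Marked e → Fin (size 𝓗)
    -- `i₀` is a placeholder: a heavy edge receives its representative instead.
    hyperedge _ (inj₁ _)       = i₀
    hyperedge _ (inj₂ (i , _)) = i
    ℓ : Fin E → Fin (size 𝓗)
    ℓ j = hyperedge (from j) (placed (from j))
    C? : ∀ j → Decidable (λ i → φ (fst F (from j)) ∈ edge 𝓗 i × φ (snd F (from j)) ∈ edge 𝓗 i)
    C? j = codegree? 𝓗 (φ (fst F (from j))) (φ (snd F (from j)))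
    need? : Decidable (λ j → HeavyE (from j))
    need? j = heavy? _ _
    R = greedy ℓ C? need? ℓ (λ j h → h)
    marked : ∀ e (p : HeavyE e ⊎ Marked e) → ¬ HeavyE e →
      (φ (fst F e) ∈ edge 𝓗 (hyperedge e p) × φ (snd F e) ∈ edge 𝓗 (hyperedge e p)) ×
      Mark (hyperedge e p) (φ (fst F e)) (φ (snd F e))
    marked _ (inj₁ h)       ¬h = contradiction h ¬h
    marked _ (inj₂ (_ , m)) _  = m
    mark-edge : ∀ e e′ {i} → Mark i (φ (fst F e)) (φ (snd F e)) →
      Mark i (φ (fst F e′)) (φ (snd F e′)) → e ≡ e′
    mark-edge e@(_ , _ , lt , _) e′@(_ , _ , lt′ , _) M M′ = case mark-unique M M′ of λ
      { (inj₁ (p , q)) → edge-≡ F e e′ (φ-inj p) (φ-inj q)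
      ; (inj₂ (p , q)) → contradiction lt (Fin.<-asym (subst₂ Fin._<_ (sym (φ-inj q)) (sym (φ-inj p)) lt′)) }
    rep-injective : ∀ j j′ → Dec (HeavyE (from j)) → Dec (HeavyE (from j′)) → rep R j ≡ rep R j′ → from j ≡ from j′
    rep-injective j j′ (yes h) (yes h′) eq = cong from (rep-inj R j j′ h h′ eq)
    rep-injective j j′ (yes h) (no ¬h′) eq =
      contradiction (trans eq (rep-other R j′ ¬h′)) (rep-avoids R j h j′)
    rep-injective j j′ (no ¬h) (yes h′) eq =
      contradiction (trans (sym eq) (rep-other R j ¬h)) (rep-avoids R j′ h′ j)
    rep-injective j j′ (no ¬h) (no ¬h′) eq = mark-edge _ _
      (proj₂ (marked (from j) (placed (from j)) ¬h))
      (subst (λ i → Mark i (φ (fst F (from j′))) (φ (snd F (from j′))))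
        (trans (sym (rep-other R j′ ¬h′)) (trans (sym eq) (rep-other R j ¬h)))
        (proj₂ (marked (from j′) (placed (from j′)) ¬h′)))
    g-inj : ∀ {e e′} → rep R (to e) ≡ rep R (to e′) → e ≡ e′
    g-inj {e} {e′} eq = trans (sym (from-to e)) (trans (rep-injective (to e) (to e′) (need? _) (need? _) eq) (from-to e′))
    Incident : Edge F → Fin (size 𝓗) → Set
    Incident e i = φ (fst F e) ∈ edge 𝓗 i × φ (snd F e) ∈ edge 𝓗 i
    rep-incident : ∀ j → Dec (HeavyE (from j)) → Incident (from j) (rep R j)
    rep-incident j (yes h) = rep-∈ R j h
    rep-incident j (no ¬h) = subst (Incident (from j)) (sym (rep-other R j ¬h)) (proj₁ (marked (from j) (placed (from j)) ¬h))
    incident : ∀ e → Incident e (rep R (to e))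
    incident e = subst (λ e′ → Incident e′ (rep R (to e))) (from-to e) (rep-incident (to e) (need? _))

-- Cliques, cherries and independent sets

module _ {n : ℕ} (H : Fin n → Fin n → Set) where

  Clique : ℕ → Set
  Clique v = ∃ λ (f : Fin v → Fin n) → Injective _≡_ _≡_ f × ∀ i j → i ≢ j → H (f i) (f j)

  Cherry : (Fin n → Set) → Set
  Cherry U = ∃₂ λ a b → ∃[ c ] (U a × U b × U c) × (a ≢ b × b ≢ c × a ≢ c) × H a b × H b c × ¬ H a c

  Independent : (Fin n → Set) → ℕ → Set
  Independent U j = ∃ λ (f : Fin j → Fin n) →
    (∀ i → U (f i)) × ∀ i i′ → i ≢ i′ → f i ≢ f i′ × ¬ H (f i) (f i′)

-- Without a cherry, "equal or related" is transitive on U, and its classes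
-- contain v elements or are more than j in number.
module _ {n : ℕ} {H : Fin n → Fin n → Set} (H? : ∀ p q → Dec (H p q)) (H-sym : ∀ {p q} → H p q → H q p) (v : ℕ) where

  clique-or-cherry-or-independent : ∀ j {U : Fin n → Set} (U? : Decidable U) →
    j * (v ∸ 1) < # U? → Clique H v ⊎ Cherry H U ⊎ Independent H U (suc j)
  clique-or-cherry-or-independent j {U} U? large = extend (#-∃ U? (≤-<-trans z≤n large)) j large
    where
    Result : ℕ → Set
    Result j = Clique H v ⊎ Cherry H U ⊎ Independent H U (suc j)
    extend : ∃ U → ∀ j → j * (v ∸ 1) < # U? → Result j
    extend (x , Ux) zero    _  = inj₂ (inj₂ ((λ _ → x) , (λ _ → Ux) , λ { zero zero 0≢0 → contradiction refl 0≢0 }))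
    -- It is enough to look for cherries centred at `x`: without one, `x` and its neighbours in `U`
    -- are pairwise related. If they are fewer than v, removing them costs at most `v ∸ 1` elements
    -- and leaves only elements unrelated to `x`, so `x` extends an independent set found among the
    -- rest.
    extend (x , Ux) (suc j) lt = by-cases (v ≤? # class?) (Fin.any? λ a → Fin.any? λ c → cherry? a c)
      where
      near? : Decidable (λ y → x ≡ y ⊎ H x y)
      near? y = x ≟ y ⊎-dec H? x y
      class? : Decidable (λ y → U y × (x ≡ y ⊎ H x y))
      class? y = U? y ×-dec near? y
      rest? : Decidable (λ y → U y × ¬ (x ≡ y ⊎ H x y))
      rest? y = U? y ×-dec ¬? (near? y)
      CherryAt : Fin n → Fin n → Set
      CherryAt a c = (U a × U c) × (a ≢ x × x ≢ c × a ≢ c) × H a x × H x c × ¬ H a c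
      cherry? : ∀ a c → Dec (CherryAt a c)
      cherry? a c = (U? a ×-dec U? c) ×-dec (¬? (a ≟ x) ×-dec ¬? (x ≟ c) ×-dec ¬? (a ≟ c)) ×-dec
        H? a x ×-dec H? x c ×-dec ¬? (H? a c)
      clique : ¬ (∃₂ CherryAt) → (∃ λ (f : Fin v → Fin n) → Injective _≡_ _≡_ f × ∀ i → U (f i) × (x ≡ f i ⊎ H x (f i))) → Clique H v
      clique ¬cherry (f , f-inj , f-∈) = f , f-inj , λ i j i≢j → related (i≢j ∘ f-inj) (f-∈ i) (f-∈ j)
        where
        related : ∀ {p q} → p ≢ q → U p × (x ≡ p ⊎ H x p) → U q × (x ≡ q ⊎ H x q) → H p q
        related p≢q (_ , inj₁ refl) (_ , inj₁ refl) = contradiction refl p≢q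
        related p≢q (_ , inj₁ refl) (_ , inj₂ h)    = h
        related p≢q (_ , inj₂ h)    (_ , inj₁ refl) = H-sym h
        related {p} {q} p≢q (Up , inj₂ h) (Uq , inj₂ h′) with H? p q | p ≟ x | x ≟ q
        ... | yes r | _        | _        = r
        ... | no ¬r | yes refl | _        = h′
        ... | no ¬r | _        | yes refl = H-sym h
        ... | no ¬r | no p≢x   | no x≢q   = contradiction (p , q , (Up , Uq) , (p≢x , x≢q , p≢q) , H-sym h , h′ , ¬r) ¬cherry
      rest-large : ¬ (v ≤ # class?) → j * (v ∸ 1) < # rest?
      rest-large small = +-cancelˡ-< (v ∸ 1) _ _ (begin-strict
        v ∸ 1 + j * (v ∸ 1)   <⟨ lt ⟩
        # U?                  ≤⟨ #-⊆-∪ U? class? rest? (λ y Uy → case near? y of λ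
                                   { (yes near) → inj₁ (Uy , near) ; (no ¬near) → inj₂ (Uy , ¬near) }) ⟩
        # class? + # rest?    ≤⟨ +-monoˡ-≤ _ (<⇒≤pred (≰⇒> small)) ⟩
        pred v + # rest?      ≡⟨ cong (_+ # rest?) (pred[n]≡n∸1 {v}) ⟩
        v ∸ 1 + # rest?       ∎)
        where
        open ≤-Reasoning
        pred[n]≡n∸1 : ∀ {v} → pred v ≡ v ∸ 1
        pred[n]≡n∸1 {zero}  = refl
        pred[n]≡n∸1 {suc v} = refl
      lift : Clique H v ⊎ Cherry H (λ y → U y × ¬ (x ≡ y ⊎ H x y)) ⊎ Independent H (λ y → U y × ¬ (x ≡ y ⊎ H x y)) (suc j) →
        Result (suc j)
      lift (inj₁ k) = inj₁ k
      lift (inj₂ (inj₁ (a , b , c , (Ua , Ub , Uc) , r))) = inj₂ (inj₁ (a , b , c , (proj₁ Ua , proj₁ Ub , proj₁ Uc) , r))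
      lift (inj₂ (inj₂ (f , f-∈ , f-ind))) = inj₂ (inj₂ (f′ , f′-∈ , f′-ind))
        where
        f′ : Fin (suc (suc j)) → Fin n
        f′ zero    = x
        f′ (suc i) = f i
        f′-∈ : ∀ i → U (f′ i)
        f′-∈ zero    = Ux
        f′-∈ (suc i) = proj₁ (f-∈ i)
        far : ∀ i → ¬ (x ≡ f i ⊎ H x (f i))
        far i = proj₂ (f-∈ i)
        f′-ind : ∀ i i′ → i ≢ i′ → f′ i ≢ f′ i′ × ¬ H (f′ i) (f′ i′)
        f′-ind zero    zero     ne = contradiction refl ne
        f′-ind zero    (suc i′) ne = far i′ ∘ inj₁ , far i′ ∘ inj₂
        f′-ind (suc i) zero     ne = far i ∘ inj₁ ∘ sym , far i ∘ inj₂ ∘ H-sym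
        f′-ind (suc i) (suc i′) ne = f-ind i i′ (ne ∘ cong suc)
      by-cases : Dec (v ≤ # class?) → Dec (∃₂ CherryAt) → Result (suc j)
      by-cases _ (yes (a , c , (Ua , Uc) , (a≢x , x≢c , a≢c) , r)) =
        inj₂ (inj₁ (a , x , c , (Ua , Ux , Uc) , (a≢x , x≢c , a≢c) , r))
      by-cases (yes v≤) (no ¬cherry) = inj₁ (clique ¬cherry (choose class? v≤))
      by-cases (no v≰)  (no ¬cherry) = lift (clique-or-cherry-or-independent j rest? (rest-large v≰))

#-⊂ : {P Q : Fin n → Set} (P? : Decidable P) (Q? : Decidable Q) →
  (∀ i → P i → Q i) → (i : Fin n) → Q i → ¬ P i → # P? < # Q?
#-⊂ P? Q? P⊆Q i Qi ¬Pi = begin-strict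
  # P?                              <⟨ n<1+n _ ⟩
  1 + # P?                          ≡⟨ cong (_+ # P?) (#-single i) ⟨
  # (i ≟_) + # P?                   ≡⟨ sum-+ (λ j → 𝟙 (i ≟ j)) _ ⟨
  sum (λ j → 𝟙 (i ≟ j) + 𝟙 (P? j))  ≤⟨ sum-mono (λ j → 𝟙-+-≤ (i ≟ j) (P? j) (Q? j) (λ { refl → Qi }) (P⊆Q j) (λ { refl → ¬Pi })) ⟩
  # Q?                              ∎
  where open ≤-Reasoning

-- Thinning to a subfamily without conflicts

Scattered : (Fin m → Fin m → Set) → (Fin m → Set) → ℕ → Set
Scattered {m} R P c = ∃ λ (f : Fin c → Fin m) → (∀ j → P (f j)) × ∀ j j′ → R (f j) (f j′) → j ≡ j′

module _ {m : ℕ} {R : Fin m → Fin m → Set} (R? : ∀ i j → Dec (R i j))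
  (R-refl : ∀ i → R i i) (R-sym : ∀ {i j} → R i j → R j i)
  (D : ℕ) (R-≤ : ∀ i → # (R? i) ≤ D) where

  -- Greedy selection: a chosen member rules out at most D members. It rules out itself by `R-refl`,
  -- which makes the fuel decrease.
  scattered-subfamily : {P : Fin m → Set} (P? : Decidable P) → ∃[ c ] # P? ≤ D * c × Scattered R P c
  scattered-subfamily P? = go (# P?) P? ≤-refl
    where
    go : ∀ fuel {P : Fin m → Set} (P? : Decidable P) → # P? ≤ fuel → ∃[ c ] # P? ≤ D * c × Scattered R P c
    go zero P? le = 0 , ≤-trans le z≤n , (λ ()) , (λ ()) , λ ()
    go (suc fuel) {P} P? le = split (Fin.any? P?)
      where
      split : Dec (∃ P) → ∃[ c ] # P? ≤ D * c × Scattered R P c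
      split (no ¬p) = 0 , ≤-trans (≤-reflexive (sum-zero λ i → 𝟙-no (P? i) λ p → ¬p (i , p))) z≤n , (λ ()) , (λ ()) , λ ()
      split (yes (i , Pi)) = cons (go fuel rest? (s≤s⁻¹ (≤-trans
          (#-⊂ rest? P? (λ _ → proj₁) i Pi λ r → proj₂ r (R-refl i)) le)))
        where
        rest? : Decidable (λ j → P j × ¬ R i j)
        rest? j = P? j ×-dec ¬? (R? i j)
        cons : ∃[ c ] # rest? ≤ D * c × Scattered R (λ j → P j × ¬ R i j) c → ∃[ c ] # P? ≤ D * c × Scattered R P c
        cons (c , le , f , f-∈ , f-inj) = suc c , bound , f′ ,
          (λ { zero → Pi ; (suc j) → proj₁ (f-∈ j) }) ,
          λ { zero zero _ → refl
            ; zero (suc j) r → contradiction r (proj₂ (f-∈ j))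
            ; (suc j) zero r → contradiction (R-sym r) (proj₂ (f-∈ j))
            ; (suc j) (suc j′) r → cong suc (f-inj j j′ r) }
          where
          f′ : Fin (suc c) → Fin m
          f′ zero    = i
          f′ (suc j) = f j
          open ≤-Reasoning
          bound : # P? ≤ D * suc c
          bound = begin
            # P?                ≤⟨ #-⊆-∪ P? (R? i) rest? (λ j Pj → case R? i j of λ
                                    { (yes r) → inj₁ r ; (no ¬r) → inj₂ (Pj , ¬r) }) ⟩
            # (R? i) + # rest?  ≤⟨ +-mono-≤ (R-≤ i) le ⟩
            D + D * c           ≡⟨ *-suc D c ⟨
            D * suc c           ∎

-- Counting triangles

-- Whether a larger value satisfies `Q` cannot be decided, so each increase appeals to excluded
-- middle under double negation. The fuel is the distance to `B`, so the increases stop.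
¬¬-bounded-max : (Q : ℕ → Set) (B : ℕ) → (∀ m → Q m → m ≤ B) →
  ∀ m₀ → Q m₀ → ¬ ¬ (∃[ m ] m₀ ≤ m × IsGreatest Q m)
¬¬-bounded-max Q B bounded m₀ Qm₀ = go B m₀ (m≤n+m B m₀) Qm₀ ≤-refl
  where
  go : ∀ fuel m → B ≤ m + fuel → Q m → m₀ ≤ m → ¬ ¬ (∃[ m ] m₀ ≤ m × IsGreatest Q m)
  go zero m B≤ Qm m₀≤ k = k (m , m₀≤ , Qm , λ m′ Qm′ →
    ≤-trans (bounded m′ Qm′) (≤-trans B≤ (≤-reflexive (+-identityʳ m))))
  go (suc fuel) m B≤ Qm m₀≤ k = ¬¬-excluded-middle {A = ∃[ m′ ] m < m′ × Q m′} λ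
    { (yes (m′ , m<m′ , Qm′)) → go fuel m′ (≤-trans B≤ (≤-trans (≤-reflexive (+-suc m fuel)) (+-monoˡ-≤ fuel m<m′)))
        Qm′ (≤-trans m₀≤ (<⇒≤ m<m′)) k
    ; (no ¬larger) → k (m , m₀≤ , Qm , λ m′ Qm′ → ≮⇒≥ λ m<m′ → ¬larger (m′ , m<m′ , Qm′)) }

module _ (S : Setoid 0ℓ 0ℓ) where

  open Setoid S using (Carrier; _≈_) renaming (refl to ≈-refl; sym to ≈-sym; trans to ≈-trans)

  Transversal : (Carrier → Set) → Set
  Transversal P = ∃₂ λ m (f : Fin m → Carrier) →
    (∀ i j → f i ≈ f j → i ≡ j) × (∀ s → P s → ∃[ j ] f j ≈ s)

  -- `R i s` says that s has code i. A code may be unrealised, or its class may already be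
  -- represented by a later code; excluded middle under double negation separates the cases, one
  -- code at a time.
  ¬¬-transversal : ∀ N (R : Fin N → Carrier → Set) → (∀ {i s t} → R i s → R i t → s ≈ t) →
    ¬ ¬ Transversal (λ s → ∃[ i ] R i s)
  ¬¬-transversal zero    R cls k = k (0 , (λ ()) , (λ ()) , λ { _ (() , _) })
  ¬¬-transversal (suc N) R cls k = ¬¬-transversal N (R ∘ suc) cls extend
    where
    extend : ¬ Transversal (λ s → ∃[ i ] R (suc i) s)
    extend (m , f , f-inj , f-sur) = ¬¬-excluded-middle {A = ∃ (R zero)} λ
      { (no ¬s) → k (m , f , f-inj , λ s → old λ r → contradiction (_ , r) ¬s)
      ; (yes (s₀ , r₀)) → ¬¬-excluded-middle {A = ∃[ j ] f j ≈ s₀} λ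
        { (yes (j , e)) → k (m , f , f-inj , λ s → old λ r → j , ≈-trans e (cls r₀ r))
        ; (no ¬j) → k (suc m , (λ { zero → s₀ ; (suc j) → f j }) ,
            (λ { zero zero _ → refl
               ; zero (suc j) e → contradiction (j , ≈-sym e) ¬j
               ; (suc i) zero e → contradiction (i , e) ¬j
               ; (suc i) (suc j) e → cong suc (f-inj i j e) }) ,
            λ { s (zero , r) → zero , cls r₀ r
              ; s (suc i , r) → let j , e = f-sur s (i , r) in suc j , e }) } }
      where
      old : ∀ {s} → (∀ {t} → R zero t → ∃[ j ] f j ≈ t) → (∃[ i ] R i s) → ∃[ j ] f j ≈ s
      old h (zero , r)  = h r
      old h (suc i , r) = f-sur _ (i , r)

  ¬¬-finite : ∀ N (R : Fin N → Carrier → Set) → (∀ {i s t} → R i s → R i t → s ≈ t) →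
    (∀ s → ∃[ i ] R i s) → ¬ ¬ (∃[ m ] Bijection (setoid (Fin m)) S)
  ¬¬-finite N R cls total k = ¬¬-transversal N R cls λ (m , f , f-inj , f-sur) → k (m , record
    { to = f
    ; cong = λ { refl → ≈-refl }
    ; bijective = f-inj _ _ , λ s → let j , e = f-sur s (total s) in j , λ { refl → e } })

module _ {n : ℕ} (G : Graph n) where

  open Setoid (Copies (complete 3) G) using (_≈_) renaming (sym to ≈-sym; trans to ≈-trans)

  Triangle : Set
  Triangle = Embedding (complete 3) G

  code : Triangle → Fin (n * n * n)
  code φ = combine (combine (Embedding.map φ zero) (Embedding.map φ (suc zero))) (Embedding.map φ (suc (suc zero)))

  code-≈ : ∀ φ ψ → code φ ≡ code ψ → φ ≈ ψ
  code-≈ φ ψ eq = (λ x → mk⇔ (transport φ ψ maps) (transport ψ φ (sym ∘ maps))) ,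
    λ x y → mk⇔ (transport₂ φ ψ maps) (transport₂ ψ φ (sym ∘ maps))
    where
    eq₀₁ = Fin.combine-injectiveˡ (combine (Embedding.map φ zero) (Embedding.map φ (suc zero))) _
      (combine (Embedding.map ψ zero) (Embedding.map ψ (suc zero))) _ eq
    maps : ∀ u → Embedding.map φ u ≡ Embedding.map ψ u
    maps zero             = Fin.combine-injectiveˡ _ _ _ _ eq₀₁
    maps (suc zero)       = Fin.combine-injectiveʳ (Embedding.map φ zero) _ (Embedding.map ψ zero) _ eq₀₁
    maps (suc (suc zero)) = Fin.combine-injectiveʳ (combine (Embedding.map φ zero) (Embedding.map φ (suc zero))) _
      (combine (Embedding.map ψ zero) (Embedding.map ψ (suc zero))) _ eq
    transport : ∀ (φ ψ : Triangle) → (∀ u → Embedding.map φ u ≡ Embedding.map ψ u) →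
      ∀ {x} → VertexOfImage φ x → VertexOfImage ψ x
    transport φ ψ eq (u , p) = u , trans (sym (eq u)) p
    transport₂ : ∀ (φ ψ : Triangle) → (∀ u → Embedding.map φ u ≡ Embedding.map ψ u) →
      ∀ {x y} → EdgeOfImage φ x y → EdgeOfImage ψ x y
    transport₂ φ ψ eq (u , w , a , p , q) = u , w , a , trans (sym (eq u)) p , trans (sym (eq w)) q

  ¬¬-counted : ¬ ¬ (∃[ m ] IsNumberOfCopies (complete 3) G m)
  ¬¬-counted = ¬¬-finite _ (n * n * n) (λ i φ → i ≡ code φ)
    (λ {_} {φ} {ψ} p q → code-≈ φ ψ (trans (sym p) q)) (λ φ → code φ , refl)

  count-≤ : ∀ {m} → IsNumberOfCopies (complete 3) G m → m ≤ n * n * n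
  count-≤ b = Fin.injective⇒≤ {f = code ∘ Bijection.to b} λ {i} {j} eq →
    Bijection.injective b (code-≈ (Bijection.to b i) (Bijection.to b j) eq)

  -- Equal copies have equal vertex sets, so triangles whose vertex sets are not contained in one
  -- another are different copies.
  ≤-count : ∀ {m c} → IsNumberOfCopies (complete 3) G m → (τ : Fin c → Triangle) →
    (∀ i j → (∀ {x} → VertexOfImage (τ i) x → VertexOfImage (τ j) x) → i ≡ j) → c ≤ m
  ≤-count {m} {c} b τ τ-inj = Fin.injective⇒≤ {f = preimage} λ {i} {j} eq →
    τ-inj i j λ {x} → Equivalence.to (proj₁ (≈-trans {τ i} {Bijection.to b (preimage i)} {τ j}
      (≈-sym {Bijection.to b (preimage i)} {τ i} (is-preimage i))
      (subst (λ p → Bijection.to b p ≈ τ j) (sym eq) (is-preimage j))) x)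
    where
    preimage : Fin c → Fin m
    preimage i = proj₁ (Bijection.surjective b (τ i))
    is-preimage : ∀ i → Bijection.to b (preimage i) ≈ τ i
    is-preimage i = proj₂ (Bijection.surjective b (τ i)) refl

-- The maximum in the definition of ex(n, K₃, F) and the number of copies are
-- only known to exist up to double negation.
few-triangles : {v : ℕ} (F : Graph v) → IsLittleO-n² (IsEx (complete 3) F) →
  ∀ k → ∃[ N ] (∀ {n} → N ≤ n → (G : Graph n) → Free F G →
    ∀ c (τ : Fin c → Triangle G) →
    (∀ i j → (∀ {x} → VertexOfImage (τ i) x → VertexOfImage (τ j) x) → i ≡ j) → k * c ≤ n * n)
few-triangles F small k = proj₁ (small k) , λ {n} N≤n G free c τ τ-inj →
  decidable-stable (k * c ≤? n * n) λ large →
  ¬¬-counted G λ (m₀ , b₀) →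
  ¬¬-bounded-max (λ m → ∃ λ (G : Graph n) → Free F G × IsNumberOfCopies (complete 3) G m) (n * n * n)
    (λ { m (G′ , _ , b) → count-≤ G′ b }) m₀ (G , free , b₀) λ (m , m₀≤m , max) →
  large (≤-trans (*-monoʳ-≤ k (≤-trans (≤-count G b₀ τ τ-inj) m₀≤m)) (proj₂ (small k) n N≤n m max))

-- Light sets and blow-ups of complete graphs

sum-injective : (h : Fin m → Fin n) → Injective _≡_ _≡_ h → (g : Fin n → ℕ) → sum (g ∘ h) ≤ sum g
sum-injective h h-inj g = ≤-trans
  (sum-pairs h (λ _ → zero {0}) (λ _ _ eq _ → h-inj eq) (λ a _ → g a))
  (≤-reflexive (sum-cong λ a → trans (sum-const 1 (g a)) (*-identityˡ (g a))))

#-any : {S : Fin m → Fin k → Set} (S? : ∀ i p → Dec (S i p)) →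
  # (λ i → Fin.any? (S? i)) ≤ sum (λ p → # (λ i → S? i p))
#-any {S = S} S? = ≤-trans (sum-mono λ i → bound i (Fin.any? (S? i))) (≤-reflexive (sum-comm λ i p → 𝟙 (S? i p)))
  where
  bound : ∀ i (d : Dec (∃ (S i))) → 𝟙 d ≤ sum (λ p → 𝟙 (S? i p))
  bound i d@(yes (p , s)) = ≤-trans (𝟙≤1 d) (≤-trans (≤-reflexive (sym (𝟙-yes (S? i p) s))) (term-≤-sum (λ p → 𝟙 (S? i p)) p))
  bound i d@(no ¬s)       = ≤-trans (≤-reflexive (𝟙-no d ¬s)) z≤n

#-all : {P : Fin n → Set} (P? : Decidable P) → (∀ i → P i) → # P? ≡ n
#-all {n} P? p = trans (sum-cong λ i → 𝟙-yes (P? i) (p i)) (trans (sum-const n 1) (*-identityʳ n))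

opaque
  unfolding sum 𝟙

  size-# : (p : Subset n) → ∣ p ∣ ≡ # (_∈? p)
  size-# [] = refl
  size-# (true  ∷ p) = cong suc (trans (size-# p) (sum-cong λ x → drop x))
    where
    drop : ∀ x → 𝟙 (x ∈? p) ≡ 𝟙 (suc x ∈? (true ∷ p))
    drop x with x ∈? p
    ... | yes _ = refl
    ... | no _  = refl
  size-# (false ∷ p) = trans (size-# p) (sum-cong λ x → drop x)
    where
    drop : ∀ x → 𝟙 (x ∈? p) ≡ 𝟙 (suc x ∈? (false ∷ p))
    drop x with x ∈? p
    ... | yes _ = refl
    ... | no _  = refl

-- A blow-up of the complete graph on q colours, with parts of size s, whose
-- edges lie in the q-sets pos e; no such set contains a rainbow triangle of it.
record Grid {n c : ℕ} (q s : ℕ) (pos : Fin c → Fin q → Fin n) : Set where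
  field
    part     : Fin q → Fin s → Fin n
    part-inj : ∀ p {i j} → part p i ≡ part p j → i ≡ j
    cross    : ∀ p r → p ≢ r → ∀ i j → ∃[ e ] pos e p ≡ part p i × pos e r ≡ part r j
    rainbow  : ∀ p q r → p ≢ q → q ≢ r → p ≢ r → ∀ e i j l →
      pos e p ≡ part p i → pos e q ≡ part q j → pos e r ≢ part r l

-- Pairs are compared position by position: two sets may still share two vertices that occupy other
-- positions.
Linear : {n c q : ℕ} → (Fin c → Fin q → Fin n) → Set
Linear pos = ∀ p r → p ≢ r → PairInjective (λ e → pos e p) (λ e → pos e r)

DenseGrids : ℕ → ℕ → Set
DenseGrids q s = ∀ k → 1 ≤ k → ∃[ N ] (∀ {n c} → N ≤ n → (pos : Fin c → Fin q → Fin n) → Linear pos →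
  n * n ≤ k * c → Grid q s pos)

dense-grids-2 : ∀ s → DenseGrids 2 s
dense-grids-2 s k 1≤k = kst-bound s k , λ N≤n pos lin dense →
  grid pos (kővári–sós–turán s k {{>-nonZero 1≤k}} N≤n _ _ (lin zero (suc zero) λ ()) dense)
  where
  grid : ∀ {n c} (pos : Fin c → Fin 2 → Fin n) →
    (∃₂ λ (a b : Fin s → Fin n) → Injective _≡_ _≡_ a × Injective _≡_ _≡_ b ×
      (∀ i j → ∃[ e ] pos e zero ≡ a i × pos e (suc zero) ≡ b j)) → Grid 2 s pos
  grid pos (a , b , a-inj , b-inj , ab) = record
    { part     = λ { zero → a ; (suc zero) → b }
    ; part-inj = λ { zero → a-inj ; (suc zero) → b-inj }
    ; cross    = λ
      { zero zero ne → contradiction refl ne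
      ; zero (suc zero) _ i j → ab i j
      ; (suc zero) zero _ i j → let e , p , q = ab j i in e , q , p
      ; (suc zero) (suc zero) ne → contradiction refl ne }
    ; rainbow  = λ
      { zero zero _ ne → contradiction refl ne
      ; zero (suc zero) zero _ _ ne → contradiction refl ne
      ; zero (suc zero) (suc zero) _ ne → contradiction refl ne
      ; (suc zero) zero zero _ ne → contradiction refl ne
      ; (suc zero) zero (suc zero) _ _ ne → contradiction refl ne
      ; (suc zero) (suc zero) _ ne → contradiction refl ne } }

dense-grids-3 : ∀ s → DenseGrids 3 s
dense-grids-3 s k 1≤k = rainbow-bound s k 1≤k , λ N≤n pos lin dense →
  grid pos (rainbow-tripartite s k 1≤k (λ e → pos e zero) (λ e → pos e (suc zero)) (λ e → pos e (suc (suc zero)))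
    (lin _ _ λ ()) (lin _ _ λ ()) (lin _ _ λ ()) N≤n dense)
  where
  grid : ∀ {n c} (pos : Fin c → Fin 3 → Fin n) →
    RainbowTripartite s (λ e → pos e zero) (λ e → pos e (suc zero)) (λ e → pos e (suc (suc zero))) → Grid 3 s pos
  grid {n} pos (a , b , c , a-inj , b-inj , c-inj , ab , ac , bc , no-triple) = record
    { part     = part
    ; part-inj = λ { zero → a-inj ; (suc zero) → b-inj ; (suc (suc zero)) → c-inj }
    ; cross    = λ
      { zero zero ne → contradiction refl ne
      ; zero (suc zero) _ i j → ab i j
      ; zero (suc (suc zero)) _ i j → ac i j
      ; (suc zero) zero _ i j → let e , p , q = ab j i in e , q , p
      ; (suc zero) (suc zero) ne → contradiction refl ne
      ; (suc zero) (suc (suc zero)) _ i j → bc i j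
      ; (suc (suc zero)) zero _ i j → let e , p , q = ac j i in e , q , p
      ; (suc (suc zero)) (suc zero) _ i j → let e , p , q = bc j i in e , q , p
      ; (suc (suc zero)) (suc (suc zero)) ne → contradiction refl ne }
    ; rainbow  = rainbow }
    where
    part : Fin 3 → Fin s → Fin n
    part zero             = a
    part (suc zero)       = b
    part (suc (suc zero)) = c
    rainbow : ∀ p q r → p ≢ q → q ≢ r → p ≢ r → ∀ e i j l →
      pos e p ≡ part p i → pos e q ≡ part q j → pos e r ≢ part r l
    rainbow zero zero _ p≢q _ _ = contradiction refl p≢q
    rainbow zero (suc zero) zero _ _ p≢r = contradiction refl p≢r
    rainbow zero (suc zero) (suc zero) _ q≢r _ = contradiction refl q≢r
    rainbow zero (suc zero) (suc (suc zero)) _ _ _ e i j l P Q R = no-triple e i j l P Q R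
    rainbow zero (suc (suc zero)) zero _ _ p≢r = contradiction refl p≢r
    rainbow zero (suc (suc zero)) (suc zero) _ _ _ e i j l P Q R = no-triple e i l j P R Q
    rainbow zero (suc (suc zero)) (suc (suc zero)) _ q≢r _ = contradiction refl q≢r
    rainbow (suc zero) zero zero _ q≢r _ = contradiction refl q≢r
    rainbow (suc zero) zero (suc zero) _ _ p≢r = contradiction refl p≢r
    rainbow (suc zero) zero (suc (suc zero)) _ _ _ e i j l P Q R = no-triple e j i l Q P R
    rainbow (suc zero) (suc zero) _ p≢q _ _ = contradiction refl p≢q
    rainbow (suc zero) (suc (suc zero)) zero _ _ _ e i j l P Q R = no-triple e l i j R P Q
    rainbow (suc zero) (suc (suc zero)) (suc zero) _ _ p≢r = contradiction refl p≢r
    rainbow (suc zero) (suc (suc zero)) (suc (suc zero)) _ q≢r _ = contradiction refl q≢r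
    rainbow (suc (suc zero)) zero zero _ q≢r _ = contradiction refl q≢r
    rainbow (suc (suc zero)) zero (suc zero) _ _ _ e i j l P Q R = no-triple e j l i Q R P
    rainbow (suc (suc zero)) zero (suc (suc zero)) _ _ p≢r = contradiction refl p≢r
    rainbow (suc (suc zero)) (suc zero) zero _ _ _ e i j l P Q R = no-triple e l j i R Q P
    rainbow (suc (suc zero)) (suc zero) (suc zero) _ q≢r _ = contradiction refl q≢r
    rainbow (suc (suc zero)) (suc zero) (suc (suc zero)) _ _ p≢r = contradiction refl p≢r
    rainbow (suc (suc zero)) (suc (suc zero)) _ p≢q _ _ = contradiction refl p≢q

module _ {v n : ℕ} (F : Graph v) (𝓗 : Hypergraph n) where

  open EdgeEnumeration (edge-enumeration F) using (E)

  -- Each edge of F goes to the set that supplies its pair. Suppose that a set supplying the edge uw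
  -- also contains the image of a vertex t at the position of its colour. If t has the colour of u
  -- or w, it is that vertex, because a set has one vertex at each position; a third colour is
  -- excluded by `rainbow`. So no set serves two edges.
  grid⇒¬BergeFree : {q c : ℕ} (col : Fin v → Fin q) → (∀ u w → Adj F u w → col u ≢ col w) →
    (pos : Fin c → Fin q → Fin n) → (∀ e p r → p ≢ r → pos e p ≢ pos e r) →
    (h : Fin c → Fin (size 𝓗)) → Injective _≡_ _≡_ h → (∀ e p → pos e p ∈ edge 𝓗 (h e)) →
    Grid q v pos → ¬ BergeFree F 𝓗
  grid⇒¬BergeFree {q} {c} col proper pos pos-≢ h h-inj pos-∈ grid =
    ¬BergeFree-from F {𝓗 = 𝓗} φ φ-inj (h ∘ slot) (g-inj ∘ h-inj) incident
    where
    open Grid grid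
    φ : Fin v → Fin n
    φ u = part (col u) u
    same-colour : ∀ {u w} → φ u ≡ φ w → col u ≡ col w → u ≡ w
    same-colour {u} {w} eq ceq = part-inj (col u) (trans eq (cong (λ p → part p w) (sym ceq)))
    φ-inj : Injective _≡_ _≡_ φ
    φ-inj {u} {w} eq = by-cases (col u ≟ col w)
      where
      by-cases : Dec (col u ≡ col w) → u ≡ w
      by-cases (yes ceq) = same-colour eq ceq
      -- Parts of different colours are disjoint: two of their vertices occur at different positions
      -- of a common set.
      by-cases (no cne)  = let e , p , r = cross (col u) (col w) cne u w in
        contradiction (trans p (trans eq (sym r))) (pos-≢ e (col u) (col w) cne)
    slotted : ∀ (e : Edge F) → ∃[ f ] pos f (col (fst F e)) ≡ φ (fst F e) × pos f (col (snd F e)) ≡ φ (snd F e)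
    slotted (u , w , _ , a) = cross (col u) (col w) (proper u w a) u w
    slot : Edge F → Fin c
    slot e = proj₁ (slotted e)
    incident : ∀ e → φ (fst F e) ∈ edge 𝓗 (h (slot e)) × φ (snd F e) ∈ edge 𝓗 (h (slot e))
    incident e = subst (_∈ edge 𝓗 (h (slot e))) (proj₁ (proj₂ (slotted e))) (pos-∈ (slot e) _) ,
                 subst (_∈ edge 𝓗 (h (slot e))) (proj₂ (proj₂ (slotted e))) (pos-∈ (slot e) _)
    OnSlot : Fin c → Fin v → Set
    OnSlot f t = pos f (col t) ≡ φ t
    endpoint : ∀ f {u w t} → col u ≢ col w → OnSlot f u → OnSlot f w → OnSlot f t → t ≡ u ⊎ t ≡ w
    endpoint f {u} {w} {t} u≢w U W T′ = by-cases (col u ≟ col t) (col w ≟ col t)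
      where
      by-cases : Dec (col u ≡ col t) → Dec (col w ≡ col t) → t ≡ u ⊎ t ≡ w
      by-cases (yes ceq) _ = inj₁ (same-colour (trans (sym T′) (trans (cong (pos f) (sym ceq)) U)) (sym ceq))
      by-cases (no _) (yes ceq) = inj₂ (same-colour (trans (sym T′) (trans (cong (pos f) (sym ceq)) W)) (sym ceq))
      by-cases (no u≢t) (no w≢t) =
        contradiction T′ (rainbow (col u) (col w) (col t) u≢w w≢t u≢t f u w t U W)
    g-inj : Injective _≡_ _≡_ slot
    g-inj {e@(u , w , u<w , a)} {e′@(u′ , w′ , u′<w′ , _)} eq = match
      (endpoint (slot e) ne U W (subst (λ f → OnSlot f u′) (sym eq) (proj₁ (proj₂ (slotted e′)))))
      (endpoint (slot e) ne U W (subst (λ f → OnSlot f w′) (sym eq) (proj₂ (proj₂ (slotted e′)))))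
      where
      ne = proper u w a
      U = proj₁ (proj₂ (slotted e))
      W = proj₂ (proj₂ (slotted e))
      match : u′ ≡ u ⊎ u′ ≡ w → w′ ≡ u ⊎ w′ ≡ w → e ≡ e′
      match (inj₁ p) (inj₂ q) = edge-≡ F e e′ (sym p) (sym q)
      match (inj₁ p) (inj₁ q) = contradiction (trans p (sym q)) (Fin.<⇒≢ u′<w′)
      match (inj₂ p) (inj₂ q) = contradiction (trans p (sym q)) (Fin.<⇒≢ u′<w′)
      match (inj₂ p) (inj₁ q) = contradiction u<w (Fin.<-asym (subst₂ Fin._<_ p q u′<w′))

  codegree-family-≤ : {c : ℕ} (h : Fin c → Fin (size 𝓗)) → Injective _≡_ _≡_ h → ∀ p r → ¬ Heavy F 𝓗 p r →
    {S : Fin c → Set} (S? : Decidable S) → (∀ e → S e → p ∈ edge 𝓗 (h e) × r ∈ edge 𝓗 (h e)) → # S? ≤ E + E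
  codegree-family-≤ h h-inj p r light S? S⊆ = ≤-trans
    (#-⊆ S? (λ e → codegree? 𝓗 p r (h e)) S⊆)
    (≤-trans (sum-injective h h-inj (λ i → 𝟙 (codegree? 𝓗 p r i))) (<⇒≤ (≰⇒> light)))

  -- A light pair lies in fewer than 2E hyperedges, so a set agrees with at most q² · 2E sets in two
  -- positions. Thinning loses this factor, whence `K`; its successor makes it positive. A family
  -- that stayed dense would contain a grid, hence a Berge copy of F.
  light-family-≤ : {q : ℕ} (k N : ℕ) → let K = suc (k * (q * (q * (E + E)))) in 2 ≤ q →
    (∀ {c} → N ≤ n → (pos : Fin c → Fin q → Fin n) → Linear pos → n * n ≤ K * c → Grid q v pos) →
    N ≤ n → BergeFree F 𝓗 → (col : Fin v → Fin q) → (∀ u w → Adj F u w → col u ≢ col w) →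
    {c : ℕ} (h : Fin c → Fin (size 𝓗)) → Injective _≡_ _≡_ h →
    (pos : Fin c → Fin q → Fin n) → (∀ e p → pos e p ∈ edge 𝓗 (h e)) →
    (∀ e p r → p ≢ r → pos e p ≢ pos e r × ¬ Heavy F 𝓗 (pos e p) (pos e r)) →
    k * c ≤ n * n
  light-family-≤ {q} k N 2≤q grids N≤n free col proper {c} h h-inj pos pos-∈ light =
    ≮⇒≥ λ large → from-subfamily large (scattered-subfamily R? R-refl R-sym D R-≤ all?)
    where
    D : ℕ
    D = q * (q * (E + E))
    R : Fin c → Fin c → Set
    R e e′ = ∃₂ λ p r → p ≢ r × pos e p ≡ pos e′ p × pos e r ≡ pos e′ r
    cell? : ∀ e p r → Decidable (λ e′ → p ≢ r × pos e p ≡ pos e′ p × pos e r ≡ pos e′ r)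
    cell? e p r e′ = ¬? (p ≟ r) ×-dec pos e p ≟ pos e′ p ×-dec pos e r ≟ pos e′ r
    R? : ∀ e e′ → Dec (R e e′)
    R? e e′ = Fin.any? λ p → Fin.any? λ r → cell? e p r e′
    R-refl : ∀ e → R e e
    R-refl e = inject≤ zero 2≤q , inject≤ (suc zero) 2≤q ,
      (λ eq → contradiction (Fin.inject≤-injective 2≤q 2≤q zero (suc zero) eq) λ ()) , refl , refl
    R-sym : ∀ {e e′} → R e e′ → R e′ e
    R-sym (p , r , ne , a , b) = p , r , ne , sym a , sym b
    R-≤ : ∀ e → # (R? e) ≤ D
    R-≤ e = ≤-trans (#-any (λ e′ p → Fin.any? λ r → cell? e p r e′)) (sum-≤-const _ λ p →
      ≤-trans (#-any (λ e′ r → cell? e p r e′)) (sum-≤-const _ λ r → cell-≤ p r (p ≟ r)))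
      where
      cell-≤ : ∀ p r → Dec (p ≡ r) → # (cell? e p r) ≤ E + E
      cell-≤ p r (yes eq) = ≤-trans (≤-reflexive (sum-zero λ e′ → 𝟙-no (cell? e p r e′) λ (ne , _) → ne eq)) z≤n
      cell-≤ p r (no ne)  = codegree-family-≤ h h-inj (pos e p) (pos e r) (proj₂ (light e p r ne)) (cell? e p r)
        λ e′ (_ , a , b) → subst (_∈ _) (sym a) (pos-∈ e′ p) , subst (_∈ _) (sym b) (pos-∈ e′ r)
    all? : Decidable {A = Fin c} (λ _ → ⊤)
    all? _ = yes tt
    from-subfamily : n * n < k * c → ¬ (∃[ c′ ] # all? ≤ D * c′ ×
      Scattered R (λ _ → ⊤) c′)
    from-subfamily large (c′ , c≤ , f , _ , f-inj) =
      grid⇒¬BergeFree col proper (pos ∘ f) (λ e p r ne → proj₁ (light (f e) p r ne)) (h ∘ f)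
        (λ eq → f-inj _ _ (subst (R _) (h-inj eq) (R-refl _))) (λ e p → pos-∈ (f e) p)
        (grids N≤n (pos ∘ f) (λ p r ne e e′ a b → f-inj e e′ (p , r , ne , a , b)) dense) free
      where
      open ≤-Reasoning
      dense : n * n ≤ suc (k * D) * c′
      dense = begin
        n * n              ≤⟨ <⇒≤ large ⟩
        k * c              ≡⟨ cong (k *_) (#-all all? (λ _ → tt)) ⟨
        k * # all?         ≤⟨ *-monoʳ-≤ k c≤ ⟩
        k * (D * c′)       ≡⟨ *-assoc k D c′ ⟨
        k * D * c′         ≤⟨ m≤n+m _ c′ ⟩
        suc (k * D) * c′   ∎

-- Triangles from cherries

module _ {n : ℕ} (G : Graph n) where

  triangle : ∀ {a b c} → Adj G a b → Adj G b c → Adj G a c → Triangle G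
  triangle {a} {b} {c} ab bc ac = record { map = map ; injective = λ {u} {w} → map-inj u w ; preserves = preserves }
    where
    flip : ∀ {p q} → Adj G p q → Adj G q p
    flip {p} {q} = subst T (Graph.adjSym G p q)
    ≢-adj : ∀ {p q} → Adj G p q → p ≢ q
    ≢-adj a refl = Graph.noLoop G _ a
    map : Fin 3 → Fin n
    map zero             = a
    map (suc zero)       = b
    map (suc (suc zero)) = c
    preserves : ∀ u w → Adj (complete 3) u w → Adj G (map u) (map w)
    preserves zero             (suc zero)       _ = ab
    preserves zero             (suc (suc zero)) _ = ac
    preserves (suc zero)       zero             _ = flip ab
    preserves (suc zero)       (suc (suc zero)) _ = bc
    preserves (suc (suc zero)) zero             _ = flip ac
    preserves (suc (suc zero)) (suc zero)       _ = flip bc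
    preserves zero             zero             ()
    preserves (suc zero)       (suc zero)       ()
    preserves (suc (suc zero)) (suc (suc zero)) ()
    map-inj : ∀ u w → map u ≡ map w → u ≡ w
    map-inj u w eq with u ≟ w
    ... | yes u≡w = u≡w
    ... | no  u≢w = contradiction eq (≢-adj (preserves u w (fromWitness-≢ u≢w)))
      where
      fromWitness-≢ : ∀ {u w} → u ≢ w → Adj (complete 3) u w
      fromWitness-≢ {u} {w} u≢w with u ≟ w
      ... | yes u≡w = contradiction u≡w u≢w
      ... | no _    = tt

  vertex : ∀ {a b c} (ab : Adj G a b) (bc : Adj G b c) (ac : Adj G a c) {x} →
    VertexOfImage (triangle ab bc ac) x → x ≡ a ⊎ x ≡ b ⊎ x ≡ c
  vertex ab bc ac (zero , refl)             = inj₁ refl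
  vertex ab bc ac (suc zero , refl)         = inj₂ (inj₁ refl)
  vertex ab bc ac (suc (suc zero) , refl)   = inj₂ (inj₂ refl)

graph : {R : Fin n → Fin n → Set} → (∀ p q → Dec (R p q)) → (∀ {p q} → R p q → R q p) →
  (∀ {p} → ¬ R p p) → Graph n
graph R? R-sym R-irr = record
  { adj    = λ p q → ⌊ R? p q ⌋
  ; adjSym = λ p q → agree (R? p q) (R? q p) R-sym R-sym
  ; noLoop = λ p r → R-irr (toWitness r) }
  where
  agree : (A? : Dec A) (B? : Dec B) → (A → B) → (B → A) → ⌊ A? ⌋ ≡ ⌊ B? ⌋
  agree (yes _) (yes _) _ _ = refl
  agree (no _)  (no _)  _ _ = refl
  agree (yes a) (no ¬b) f _ = contradiction (f a) ¬b
  agree (no ¬a) (yes b) _ g = contradiction (g b) ¬a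

module _ {v n : ℕ} (F : Graph v) (𝓗 : Hypergraph n) where

  open EdgeEnumeration (edge-enumeration F) using (E)

  private
    Hv : Fin n → Fin n → Set
    Hv = Heavy F 𝓗
    Hv-sym : ∀ {p q} → Hv p q → Hv q p
    Hv-sym {p} {q} = heavy-sym F 𝓗 {p} {q}

  clique⇒¬BergeFree : Fin (size 𝓗) → Clique Hv v → ¬ BergeFree F 𝓗
  clique⇒¬BergeFree i₀ (f , f-inj , heavy) = ¬BergeFree-from-heavy-or-marked F 𝓗 i₀ {λ _ _ _ → ⊥} (λ ()) f f-inj
    λ (u , w , u<w , _) → inj₁ (heavy u w (Fin.<⇒≢ u<w))

  module Cherries {c : ℕ} (h : Fin c → Fin (size 𝓗)) (h-inj : Injective _≡_ _≡_ h)
    (α β γ : Fin c → Fin n)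
    (α-∈ : ∀ e → α e ∈ edge 𝓗 (h e)) (γ-∈ : ∀ e → γ e ∈ edge 𝓗 (h e))
    (α≢β : ∀ e → α e ≢ β e) (β≢γ : ∀ e → β e ≢ γ e) (α≢γ : ∀ e → α e ≢ γ e)
    (αβ : ∀ e → Hv (α e) (β e)) (βγ : ∀ e → Hv (β e) (γ e)) (αγ : ∀ e → ¬ Hv (α e) (γ e)) where

    same? : (p q p′ q′ : Fin n) → Dec (SamePair p q p′ q′)
    same? p q p′ q′ = (p ≟ p′ ×-dec q ≟ q′) ⊎-dec (p ≟ q′ ×-dec q ≟ p′)

    Joined : Fin n → Fin n → Set
    Joined p q = p ≢ q × (Hv p q ⊎ ∃[ e ] SamePair (α e) (γ e) p q)

    joined? : ∀ p q → Dec (Joined p q)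
    joined? p q = ¬? (p ≟ q) ×-dec (heavy? F 𝓗 p q ⊎-dec Fin.any? λ e → same? (α e) (γ e) p q)

    joined-sym : ∀ {p q} → Joined p q → Joined q p
    joined-sym (ne , inj₁ hv)             = ne ∘ sym , inj₁ (Hv-sym hv)
    joined-sym (ne , inj₂ (e , inj₁ s)) = ne ∘ sym , inj₂ (e , inj₂ s)
    joined-sym (ne , inj₂ (e , inj₂ s)) = ne ∘ sym , inj₂ (e , inj₁ s)

    G : Graph n
    G = graph joined? joined-sym (λ j → proj₁ j refl)

    -- In a copy of F, a light edge joins the ends of a cherry, and it is marked by the hyperedge of
    -- that cherry. Since `h` is injective, each hyperedge has one cherry and marks one pair.
    G-free : Fin (size 𝓗) → BergeFree F 𝓗 → Free F G
    G-free i₀ free ψ = ¬BergeFree-from-heavy-or-marked F 𝓗 i₀ {Mark} mark-unique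
      (Embedding.map ψ) (Embedding.injective ψ) placed free
      where
      Mark : Fin (size 𝓗) → Fin n → Fin n → Set
      Mark i p q = ∃[ e ] h e ≡ i × SamePair (α e) (γ e) p q
      mark-unique : ∀ {i p q p′ q′} → Mark i p q → Mark i p′ q′ → SamePair p q p′ q′
      mark-unique {p′ = p′} {q′} (e , he , s) (e′ , he′ , s′) =
        merge s (subst (λ e → SamePair (α e) (γ e) p′ q′) (h-inj (trans he′ (sym he))) s′)
        where
        merge : ∀ {a c p q p′ q′} → SamePair a c p q → SamePair a c p′ q′ → SamePair p q p′ q′
        merge (inj₁ (refl , refl)) s                    = s
        merge (inj₂ (refl , refl)) (inj₁ (refl , refl)) = inj₂ (refl , refl)
        merge (inj₂ (refl , refl)) (inj₂ (refl , refl)) = inj₁ (refl , refl)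
      φ = Embedding.map ψ
      placed : ∀ e → Hv (φ (fst F e)) (φ (snd F e)) ⊎ ∃[ i ]
        (φ (fst F e) ∈ edge 𝓗 i × φ (snd F e) ∈ edge 𝓗 i) × Mark i (φ (fst F e)) (φ (snd F e))
      placed (u , w , _ , a) = place (proj₂ (toWitness {a? = joined? (φ u) (φ w)} (Embedding.preserves ψ u w a)))
        where
        place : ∀ {p q} → Hv p q ⊎ (∃[ e ] SamePair (α e) (γ e) p q) →
          Hv p q ⊎ ∃[ i ] (p ∈ edge 𝓗 i × q ∈ edge 𝓗 i) × Mark i p q
        place (inj₁ hv) = inj₁ hv
        place (inj₂ (e , s@(inj₁ (refl , refl)))) = inj₂ (h e , (α-∈ e , γ-∈ e) , e , refl , s)
        place (inj₂ (e , s@(inj₂ (refl , refl)))) = inj₂ (h e , (γ-∈ e , α-∈ e) , e , refl , s)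

    joined-αβ : ∀ e → Adj G (α e) (β e)
    joined-αβ e = fromWitness (α≢β e , inj₁ (αβ e))
    joined-βγ : ∀ e → Adj G (β e) (γ e)
    joined-βγ e = fromWitness (β≢γ e , inj₁ (βγ e))
    joined-αγ : ∀ e → Adj G (α e) (γ e)
    joined-αγ e = fromWitness (α≢γ e , inj₂ (e , inj₁ (refl , refl)))

    τ : Fin c → Triangle G
    τ e = triangle G (joined-αβ e) (joined-βγ e) (joined-αγ e)

    -- αγ is the only light side of the triangle.
    τ-light : ∀ e e′ → (∀ {x} → VertexOfImage (τ e) x → VertexOfImage (τ e′) x) → SamePair (α e) (γ e) (α e′) (γ e′)
    τ-light e e′ sub = match (vertex′ (sub (zero , refl))) (vertex′ (sub (suc (suc zero) , refl)))
      where
      vertex′ : ∀ {x} → VertexOfImage (τ e′) x → x ≡ α e′ ⊎ x ≡ β e′ ⊎ x ≡ γ e′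
      vertex′ = vertex G (joined-αβ e′) (joined-βγ e′) (joined-αγ e′)
      impossible : ∀ {p q} → α e ≡ p → γ e ≡ q → Hv p q → SamePair (α e) (γ e) (α e′) (γ e′)
      impossible refl refl hv = contradiction hv (αγ e)
      match : α e ≡ α e′ ⊎ α e ≡ β e′ ⊎ α e ≡ γ e′ → γ e ≡ α e′ ⊎ γ e ≡ β e′ ⊎ γ e ≡ γ e′ → SamePair (α e) (γ e) (α e′) (γ e′)
      match (inj₁ p)        (inj₁ q)        = contradiction (trans p (sym q)) (α≢γ e)
      match (inj₁ p)        (inj₂ (inj₁ q)) = impossible p q (αβ e′)
      match (inj₁ p)        (inj₂ (inj₂ q)) = inj₁ (p , q)
      match (inj₂ (inj₁ p)) (inj₁ q)        = impossible p q (Hv-sym (αβ e′))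
      match (inj₂ (inj₁ p)) (inj₂ (inj₁ q)) = contradiction (trans p (sym q)) (α≢γ e)
      match (inj₂ (inj₁ p)) (inj₂ (inj₂ q)) = impossible p q (βγ e′)
      match (inj₂ (inj₂ p)) (inj₁ q)        = inj₂ (p , q)
      match (inj₂ (inj₂ p)) (inj₂ (inj₁ q)) = impossible p q (Hv-sym (βγ e′))
      match (inj₂ (inj₂ p)) (inj₂ (inj₂ q)) = contradiction (trans p (sym q)) (α≢γ e)

    -- Several hyperedges may yield the same light pair, but fewer than 2E contain it. The loss of a
    -- factor 2E makes the light pairs, and by `τ-light` the triangles, distinct.
    distinct-light : ∃[ c′ ] c ≤ (E + E) * c′ × ∃ λ (f : Fin c′ → Fin c) →
      ∀ j j′ → SamePair (α (f j)) (γ (f j)) (α (f j′)) (γ (f j′)) → j ≡ j′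
    distinct-light = rearrange (scattered-subfamily R? R-refl R-sym (E + E) R-≤ {λ _ → ⊤} (λ _ → yes tt))
      where
      R : Fin c → Fin c → Set
      R e e′ = SamePair (α e) (γ e) (α e′) (γ e′)
      R? : ∀ e e′ → Dec (R e e′)
      R? e e′ = same? (α e) (γ e) (α e′) (γ e′)
      R-refl : ∀ e → R e e
      R-refl e = inj₁ (refl , refl)
      R-sym : ∀ {e e′} → R e e′ → R e′ e
      R-sym (inj₁ (p , q)) = inj₁ (sym p , sym q)
      R-sym (inj₂ (p , q)) = inj₂ (sym q , sym p)
      R-≤ : ∀ e → # (R? e) ≤ E + E
      R-≤ e = codegree-family-≤ F 𝓗 h h-inj (α e) (γ e) (αγ e) (R? e) λ
        { e′ (inj₁ (p , q)) → subst (_∈ _) (sym p) (α-∈ e′) , subst (_∈ _) (sym q) (γ-∈ e′)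
        ; e′ (inj₂ (p , q)) → subst (_∈ _) (sym p) (γ-∈ e′) , subst (_∈ _) (sym q) (α-∈ e′) }
      rearrange : (∃[ c′ ] # {c} {λ _ → ⊤} (λ _ → yes tt) ≤ (E + E) * c′ × Scattered R (λ _ → ⊤) c′) → _
      rearrange (c′ , c≤ , f , _ , f-inj) =
        c′ , ≤-trans (≤-reflexive (sym (#-all {c} {λ _ → ⊤} (λ _ → yes tt) λ _ → tt))) c≤ , f , f-inj

    cherries-≤ : Fin (size 𝓗) → BergeFree F 𝓗 → (k : ℕ) →
      (∀ (G : Graph n) → Free F G → ∀ c (τ : Fin c → Triangle G) →
        (∀ i j → (∀ {x} → VertexOfImage (τ i) x → VertexOfImage (τ j) x) → i ≡ j) →
        k * (E + E) * c ≤ n * n) → k * c ≤ n * n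
    cherries-≤ i₀ free k few = bound distinct-light
      where
      open ≤-Reasoning
      bound : (∃[ c′ ] c ≤ (E + E) * c′ × ∃ λ (f : Fin c′ → Fin c) →
        ∀ j j′ → SamePair (α (f j)) (γ (f j)) (α (f j′)) (γ (f j′)) → j ≡ j′) → k * c ≤ n * n
      bound (c′ , c≤ , f , f-inj) = begin
        k * c                 ≤⟨ *-monoʳ-≤ k c≤ ⟩
        k * ((E + E) * c′)    ≡⟨ *-assoc k (E + E) c′ ⟨
        k * (E + E) * c′      ≤⟨ few G (G-free i₀ free) c′ (τ ∘ f) (λ i j sub → f-inj i j (τ-light (f i) (f j) sub)) ⟩
        n * n                 ∎

-- Triangles in complete tripartite graphs

module Tripartite (q : ℕ) where

  class : Fin (q * 3) → Fin 3
  class x = proj₂ (remQuot {q} 3 x)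

  G : Graph (q * 3)
  G = graph {R = λ x y → class x ≢ class y} (λ x y → ¬? (class x ≟ class y)) (λ ne → ne ∘ sym) (λ ne → ne refl)

  embedding⇒3-colourable : {v : ℕ} {F : Graph v} → Embedding F G → Colourable F 3
  embedding⇒3-colourable ψ = class ∘ Embedding.map ψ , λ u w a → toWitness (Embedding.preserves ψ u w a)

  corner : Fin q → Fin 3 → Fin (q * 3)
  corner i p = combine i p

  corner-inj : ∀ i j p r → corner i p ≡ corner j r → i ≡ j × p ≡ r
  corner-inj i j p r = Fin.combine-injective i p j r

  adjacent : ∀ i j p r → p ≢ r → Adj G (corner i p) (corner j r)
  adjacent i j p r ne = fromWitness λ eq → ne (trans (sym (cong proj₂ (Fin.remQuot-combine i p)))
    (trans eq (cong proj₂ (Fin.remQuot-combine j r))))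

  i₁ i₂ i₃ : Fin (q * q * q) → Fin q
  i₁ t = proj₁ (remQuot {q} q (proj₁ (remQuot {q * q} q t)))
  i₂ t = proj₂ (remQuot {q} q (proj₁ (remQuot {q * q} q t)))
  i₃ t = proj₂ (remQuot {q * q} q t)

  coordinates : ∀ t → combine (combine (i₁ t) (i₂ t)) (i₃ t) ≡ t
  coordinates t = trans
    (cong (λ s → combine s (i₃ t)) (Fin.combine-remQuot {q} q (proj₁ (remQuot {q * q} q t))))
    (Fin.combine-remQuot {q * q} q t)

  module _ (t : Fin (q * q * q)) where
    side₁₂ = adjacent (i₁ t) (i₂ t) zero (suc zero) λ ()
    side₂₃ = adjacent (i₂ t) (i₃ t) (suc zero) (suc (suc zero)) λ ()
    side₁₃ = adjacent (i₁ t) (i₃ t) zero (suc (suc zero)) λ ()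

    τ : Triangle G
    τ = triangle G side₁₂ side₂₃ side₁₃

    coordinate : Fin 3 → Fin q
    coordinate zero             = i₁ t
    coordinate (suc zero)       = i₂ t
    coordinate (suc (suc zero)) = i₃ t

    τ-corner : ∀ i p → VertexOfImage τ (corner i p) → i ≡ coordinate p
    τ-corner i p V = [ at-corner zero , [ at-corner (suc zero) , at-corner (suc (suc zero)) ]′ ]′
      (vertex G side₁₂ side₂₃ side₁₃ V)
      where
      at-corner : ∀ r → corner i p ≡ corner (coordinate r) r → i ≡ coordinate p
      at-corner r eq = let i≡ , p≡r = corner-inj i (coordinate r) p r eq in
        trans i≡ (cong coordinate (sym p≡r))

  τ-inj : ∀ s t → (∀ {x} → VertexOfImage (τ s) x → VertexOfImage (τ t) x) → s ≡ t
  τ-inj s t sub = trans (sym (coordinates s)) (trans (cong₂ combine (cong₂ combine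
      (τ-corner t (i₁ s) zero (sub (zero , refl)))
      (τ-corner t (i₂ s) (suc zero) (sub (suc zero , refl))))
      (τ-corner t (i₃ s) (suc (suc zero)) (sub (suc (suc zero) , refl)))) (coordinates t))

few-triangles⇒3-colourable : {v : ℕ} (F : Graph v) → IsLittleO-n² (IsEx (complete 3) F) →
  ¬ ¬ Colourable F 3
-- The q³ triangles exceed (3q)² as soon as q ≥ 10, so k = 1 suffices; adding N makes the 3q
-- vertices numerous enough.
few-triangles⇒3-colourable {v} F small ¬col = absurd (10 + N) ≤-refl (≤-trans (m≤n+m N 10) (m≤m*n (10 + N) 3))
  where
  open ≤-Reasoning
  N : ℕ
  N = proj₁ (few-triangles F small 1)
  absurd : ∀ q → 10 + N ≤ q → N ≤ q * 3 → ⊥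
  absurd q 10≤q N≤n = <-irrefl refl (begin-strict
    q * 3 * (q * 3)    ≡⟨ solve 1 (λ q → q :* con 3 :* (q :* con 3) := con 9 :* (q :* q)) refl q ⟩
    9 * (q * q)        <⟨ *-monoˡ-< (q * q) {{>-nonZero (*-mono-≤ 1≤q 1≤q)}} (≤-trans (m≤m+n 10 N) 10≤q) ⟩
    q * (q * q)        ≡⟨ trans (sym (*-assoc q q q)) (sym (*-identityˡ _)) ⟩
    1 * (q * q * q)    ≤⟨ proj₂ (few-triangles F small 1) N≤n G (¬col ∘ embedding⇒3-colourable) (q * q * q) τ τ-inj ⟩
    q * 3 * (q * 3)    ∎)
    where
    open Tripartite q
    1≤q : 1 ≤ q
    1≤q = ≤-trans (s≤s z≤n) 10≤q

-- Bounding the threshold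

edgeless⇒¬BergeFree : {v n : ℕ} (F : Graph v) → (∀ u w → ¬ Adj F u w) → v ≤ n →
  (𝓗 : Hypergraph n) → ¬ BergeFree F 𝓗
edgeless⇒¬BergeFree F edgeless v≤n 𝓗 = ¬BergeFree-from F {𝓗 = 𝓗} (λ u → inject≤ u v≤n)
  (λ {u} {w} → Fin.inject≤-injective v≤n v≤n u w) (λ e → ⊥-elim (none e)) (λ {e} → ⊥-elim (none e)) (λ e → ⊥-elim (none e))
  where
  none : ¬ Edge F
  none (u , w , _ , a) = edgeless u w a

berge-littleO : {v q : ℕ} (F : Graph v) → 2 ≤ q → DenseGrids q v → Colourable F q →
  IsLittleO-n² (IsEx (complete 3) F) → ∀ r → (q ∸ 1) * (v ∸ 1) < r → IsLittleO-n² (IsExBerge r F)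
berge-littleO {v} {suc j} F 2≤q grids (col , proper) small r large k = N₁ + N₂ , λ
  { n N≤n m ((𝓗 , uniform , free , refl) , _) →
    Counting.size-≤ n (≤-trans (m≤m+n N₁ N₂) N≤n) (≤-trans (m≤n+m N₂ N₁) N≤n) 𝓗 uniform free }
  where
  open EdgeEnumeration (edge-enumeration F) using (E)
  q : ℕ
  q = suc j
  K : ℕ
  K = suc (2 * k * (q * (q * (E + E))))
  -- The factor 2 splits n²/k evenly between the two kinds of hyperedges; `E + E` repays the passage
  -- to distinct light pairs.
  fewT = few-triangles F small (2 * k * (E + E))
  N₁ N₂ : ℕ
  N₁ = proj₁ fewT
  N₂ = proj₁ (grids K (s≤s z≤n))
  module Counting (n : ℕ) (N₁≤n : N₁ ≤ n) (N₂≤n : N₂ ≤ n) (𝓗 : Hypergraph n)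
    (uniform : Uniform r 𝓗) (free : BergeFree F 𝓗) where
    Hv-sym : ∀ {p r} → Heavy F 𝓗 p r → Heavy F 𝓗 r p
    Hv-sym {p} {r} = heavy-sym F 𝓗 {p} {r}
    CherryIn IndependentIn : Fin (size 𝓗) → Set
    CherryIn i      = Cherry (Heavy F 𝓗) (_∈ edge 𝓗 i)
    IndependentIn i = Independent (Heavy F 𝓗) (_∈ edge 𝓗 i) q
    kind : ∀ i → CherryIn i ⊎ IndependentIn i
    kind i = [ (λ κ → contradiction free (clique⇒¬BergeFree F 𝓗 i κ)) , id ]′
      -- Strictness of `large` matters: up to (q - 1)(v - 1) vertices could be split into q - 1
      -- classes of at most v - 1.
      (clique-or-cherry-or-independent (heavy? F 𝓗) Hv-sym v j (_∈? edge 𝓗 i)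
        (≤-trans large (≤-reflexive (trans (sym (uniform i)) (size-# (edge 𝓗 i))))))
    IsCherry IsIndependent : Fin (size 𝓗) → Set
    IsCherry i      = ∃[ κ ] kind i ≡ inj₁ κ
    IsIndependent i = ∃[ κ ] kind i ≡ inj₂ κ
    isCherry? : Decidable IsCherry
    isCherry? i with kind i
    ... | inj₁ κ = yes (κ , refl)
    ... | inj₂ _ = no λ ()
    isIndependent? : Decidable IsIndependent
    isIndependent? i with kind i
    ... | inj₁ _ = no λ ()
    ... | inj₂ κ = yes (κ , refl)
    either : ∀ i → IsCherry i ⊎ IsIndependent i
    either i with kind i
    ... | inj₁ κ = inj₁ (κ , refl)
    ... | inj₂ κ = inj₂ (κ , refl)

    cherry-≤ : 2 * k * # isCherry? ≤ n * n
    cherry-≤ = by-cases (# isCherry?) (enumerate isCherry?)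
      where
      by-cases : ∀ c → Enumeration IsCherry c → 2 * k * c ≤ n * n
      -- Without a cherry there may be no hyperedge to serve as the placeholder `i₀`, so this case
      -- is separate.
      by-cases zero    En = ≤-trans (≤-reflexive (*-zeroʳ (2 * k))) z≤n
      by-cases (suc c) En = Cherries.cherries-≤ F 𝓗 (at En) (at-inj En) α β γ
        (λ e → proj₁ (proj₁ (info e))) (λ e → proj₂ (proj₂ (proj₁ (info e))))
        (λ e → proj₁ (proj₁ (proj₂ (info e)))) (λ e → proj₁ (proj₂ (proj₁ (proj₂ (info e))))) (λ e → proj₂ (proj₂ (proj₁ (proj₂ (info e)))))
        (λ e → proj₁ (proj₂ (proj₂ (info e)))) (λ e → proj₁ (proj₂ (proj₂ (proj₂ (info e))))) (λ e → proj₂ (proj₂ (proj₂ (proj₂ (info e)))))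
        (at En zero) free (2 * k) (proj₂ fewT N₁≤n)
        where
        κ : ∀ e → CherryIn (at En e)
        κ e = proj₁ (at-∈ En e)
        α β γ : Fin (suc c) → Fin n
        α e = proj₁ (κ e)
        β e = proj₁ (proj₂ (κ e))
        γ e = proj₁ (proj₂ (proj₂ (κ e)))
        info : ∀ e → (α e ∈ edge 𝓗 (at En e) × β e ∈ edge 𝓗 (at En e) × γ e ∈ edge 𝓗 (at En e)) ×
          (α e ≢ β e × β e ≢ γ e × α e ≢ γ e) ×
          Heavy F 𝓗 (α e) (β e) × Heavy F 𝓗 (β e) (γ e) × ¬ Heavy F 𝓗 (α e) (γ e)
        info e = proj₂ (proj₂ (proj₂ (κ e)))

    independent-≤ : 2 * k * # isIndependent? ≤ n * n
    independent-≤ = light-family-≤ F 𝓗 (2 * k) N₂ 2≤q (proj₂ (grids K (s≤s z≤n))) N₂≤n free col proper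
      (at En) (at-inj En) (λ e → proj₁ (κ e)) (λ e → proj₁ (proj₂ (κ e))) (λ e → proj₂ (proj₂ (κ e)))
      where
      En : Enumeration IsIndependent (# isIndependent?)
      En = enumerate isIndependent?
      κ : ∀ e → IndependentIn (at En e)
      κ e = proj₁ (at-∈ En e)

    size-≤ : k * size 𝓗 ≤ n * n
    size-≤ = *-cancelˡ-≤ 2 (begin
      2 * (k * size 𝓗)
        ≡⟨ *-assoc 2 k (size 𝓗) ⟨
      2 * k * size 𝓗
        ≡⟨ cong (2 * k *_) (#-all {P = λ _ → ⊤} (λ _ → yes tt) λ _ → tt) ⟨
      2 * k * # {size 𝓗} {λ _ → ⊤} (λ _ → yes tt)
        ≤⟨ *-monoʳ-≤ (2 * k) (#-⊆-∪ (λ _ → yes tt) isCherry? isIndependent? (λ i _ → either i)) ⟩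
      2 * k * (# isCherry? + # isIndependent?)
        ≡⟨ *-distribˡ-+ (2 * k) (# isCherry?) _ ⟩
      2 * k * # isCherry? + 2 * k * # isIndependent?
        ≤⟨ +-mono-≤ cherry-≤ independent-≤ ⟩
      n * n + n * n
        ≡⟨ cong (n * n +_) (+-identityʳ (n * n)) ⟨
      2 * (n * n) ∎)
      where open ≤-Reasoning

theorem5 : ∀ {v : ℕ} (F : Graph v) (χ t : ℕ) →
    IsChromaticNumber F χ →
    IsUniformityThreshold F t →
    IsLittleO-n² (IsEx (complete 3) F) →
    t ≤ (χ ∸ 1) * (v ∸ 1) + 1
theorem5 {v} F χ t (col , minimal) (_ , least) small =
  least ((χ ∸ 1) * (v ∸ 1) + 1) (λ r r≥ → berge χ col minimal r (≤-trans (≤-reflexive (+-comm 1 _)) r≥))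
  where
  -- For n ≥ v the empty subhypergraph is a Berge copy of an edgeless F, so the extremal function
  -- has no value to bound.
  edgeless : ∀ r → (∀ u w → ¬ Adj F u w) → IsLittleO-n² (IsExBerge r F)
  edgeless r none k = v , λ { n v≤n m ((𝓗 , _ , free , _) , _) → contradiction free (edgeless⇒¬BergeFree F none v≤n 𝓗) }
  berge : ∀ χ → Colourable F χ → (∀ k → Colourable F k → χ ≤ k) → ∀ r → (χ ∸ 1) * (v ∸ 1) < r →
    IsLittleO-n² (IsExBerge r F)
  berge 0 (c , _) _ r _ = edgeless r λ u _ _ → Fin.¬Fin0 (c u)
  berge 1 (c , proper) _ r _ = edgeless r λ u w a → proper u w a (one (c u) (c w))
    where
    one : (p q : Fin 1) → p ≡ q
    one zero zero = refl
  berge 2 col _ r large = berge-littleO F ≤-refl (dense-grids-2 v) col small r large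
  berge 3 col _ r large = berge-littleO F (s≤s (s≤s z≤n)) (dense-grids-3 v) col small r large
  berge (suc (suc (suc (suc χ)))) _ minimal _ _ = ⊥-elim (few-triangles⇒3-colourable F small λ col₃ →
    contradiction (minimal 3 col₃) λ { (s≤s (s≤s (s≤s ()))) })
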